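{- For all integers $n \geq 1$ and all real $x$, $$c_n(x) = c_n + (-1)^n n \sum_{m=1}^n \frac{1}{m} \genfrac{[}{]}{0pt}{}{n-1}{m-1} x^m$$ and $$\widehat{c}_n(x) = c_n + (-1)^n n \sum_{m=1}^n \frac{(-1)^{m}}{m} \genfrac{[}{]}{0pt}{}{n-1}{m-1}(x-1)^m,$$ where the Cauchy numbers of the first kind $c_n$ can be expressed in terms of Bernoulli numbers as $$c_n = \delta_{n,1} + (-1)^{n+1} n \sum_{m=1}^n \genfrac{[}{]}{0pt}{}{n-1}{m-1} \frac{B_m}{m}, \qquad n \geq 1.$$
   Context: For real $z$ and integer $n\ge 0$, $\binom{z}{n} = \frac{z(z-1)\cdots(z-n+1)}{n!}$. The Cauchy polynomials of the first and second kind are $c_n(x) = n! \int_{0}^{1} \binom{t - x}{n}\, dt$ and $\widehat{c}_n(x) = n! \int_{0}^{1} \binom{x - t}{n}\, dt$, $n \ge 0$; the Cauchy numbers of the first kind are $c_n = c_n(0)$. $\genfrac{[}{]}{0pt}{}{n}{m}$ are the unsigned Stirling numbers of the first kind. $B_m$ are the Bernoulli numbers defined by $\frac{t}{e^t-1}=\sum_{m\ge0} B_m \frac{t^m}{m!}$ (so $B_1=-\tfrac12$). $\delta_{n,1}$ is the Kronecker delta. -}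

module Defs where

open import Algebra.Apartness.Bundles using (HeytingField)
open import Algebra.Bundles using (CommutativeRing; Semiring)
open import Data.Bool.Base using (if_then_else_)
open import Data.Fin.Base using (Fin; zero; suc; toℕ; inject₁; fromℕ)
open import Data.Nat.Base as ℕ using (ℕ; zero; suc; NonZero; _∸_)
open import Data.Nat.Properties using (_!≢0; _≟_)
open import Data.Product.Base using (_×_; _,_; ∃; ∃-syntax; proj₁; proj₂)
open import Data.Sum.Base using (_⊎_; inj₁; inj₂)
open import Data.Vec.Base using (Vec; []; _∷_; head; lookup)
open import Level using (_⊔_) renaming (suc to lsuc)
open import Relation.Binary.Core using (Rel)
open import Relation.Binary.PropositionalEquality.Core as ≡ using (_≡_)
open import Relation.Binary.Structures using (IsStrictPartialOrder)
open import Relation.Nullary.Decidable.Core using (⌊_⌋)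
open import Relation.Nullary.Negation.Core using (¬_; contradiction)

-- Unsigned, of the first kind: the coefficients of x (x + 1) ⋯ (x + n - 1).
stirling₁ : ℕ → ℕ → ℕ
stirling₁ zero    zero    = 1
stirling₁ zero    (suc m) = 0
stirling₁ (suc n) zero    = 0
stirling₁ (suc n) (suc m) = n ℕ.* stirling₁ n (suc m) ℕ.+ stirling₁ n m

module FieldNotions {a ℓ₁ ℓ₂} (F : HeytingField a ℓ₁ ℓ₂) where

  open HeytingField F

  commutativeRing : CommutativeRing a ℓ₁
  commutativeRing = record { isCommutativeRing = isCommutativeRing }

  open CommutativeRing commutativeRing public using (semiring; ring)
  open import Algebra.Definitions.RawSemiring (Semiring.rawSemiring semiring) public
    using (_^_; sum; product) renaming (_×_ to _·_)

  ⟦_⟧ : ℕ → Carrier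
  ⟦ n ⟧ = n · 1#

  module Order {ℓ₃} (_<_ : Rel Carrier ℓ₃) where

    infix 4 _≤_
    _≤_ : Rel Carrier ℓ₃
    x ≤ y = ¬ (y < x)

    -- ∣ x - y ∣ < ε
    Within : Carrier → Carrier → Carrier → Set ℓ₃
    Within ε x y = ((- ε) < (x - y)) × ((x - y) < ε)

    Cauchy : (ℕ → Carrier) → Set (a ⊔ ℓ₃)
    Cauchy s = ∀ ε → 0# < ε → ∃[ N ] ∀ m n → N ℕ.≤ m → N ℕ.≤ n → Within ε (s m) (s n)

    ConvergesTo : (ℕ → Carrier) → Carrier → Set (a ⊔ ℓ₃)
    ConvergesTo s l = ∀ ε → 0# < ε → ∃[ N ] ∀ n → N ℕ.≤ n → Within ε (s n) l

-- An axiomatisation of the real numbers, as a Cauchy-complete Archimedean ordered field.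
-- The axioms are the constructive ones (equality is a setoid equality, inversion
-- is available for elements apart from zero, order need not be decidable).
record RealField a ℓ₁ ℓ₂ ℓ₃ : Set (lsuc (a ⊔ ℓ₁ ⊔ ℓ₂ ⊔ ℓ₃)) where
  infix 4 _<_
  field
    heytingField : HeytingField a ℓ₁ ℓ₂

  open HeytingField heytingField public
  open FieldNotions heytingField public

  field
    _<_                    : Rel Carrier ℓ₃
    <-isStrictPartialOrder : IsStrictPartialOrder _≈_ _<_
    #⇒<∨>                  : ∀ {x y} → x # y → x < y ⊎ y < x
    <⇒#                    : ∀ {x y} → x < y → x # y
    +-monoˡ-<              : ∀ {x y} z → x < y → x + z < y + z
    *-pos                  : ∀ {x y} → 0# < x → 0# < y → 0# < x * y
    archimedean            : ∀ x → ∃[ n ] x < ⟦ n ⟧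

  open Order _<_ public

  field
    complete : ∀ s → Cauchy s → ∃[ l ] ConvergesTo s l

module Reals {a ℓ₁ ℓ₂ ℓ₃} (ℝ : RealField a ℓ₁ ℓ₂ ℓ₃) where

  open RealField ℝ hiding (zero)
  open import Algebra.Properties.Ring ring
    using (-‿involutive; -1*x≈-x)
  open import Algebra.Properties.Semiring.Mult semiring using (×-homo-1)
  open import Algebra.Properties.Semiring.Sum semiring using (sum-cong-≋)
  open import Algebra.Apartness.Properties.HeytingCommutativeRing
    heytingCommutativeRing using (1#0; x-0≈x)
  open import Relation.Binary.Reasoning.Setoid setoid
  private module < = IsStrictPartialOrder <-isStrictPartialOrder

  private
    0<1 : 0# < 1#
    0<1 with #⇒<∨> 1#0
    ... | inj₂ 0<1 = 0<1
    ... | inj₁ 1<0 = contradiction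
      (<.trans (<.<-respʳ-≈ -1*-1≈1 (*-pos 0<-1 0<-1)) 1<0) (<.irrefl refl)
      where
      0<-1 : 0# < - 1#
      0<-1 = <.<-respˡ-≈ (-‿inverseʳ 1#)
               (<.<-respʳ-≈ (+-identityˡ _) (+-monoˡ-< (- 1#) 1<0))
      -1*-1≈1 : (- 1#) * (- 1#) ≈ 1#
      -1*-1≈1 = trans (-1*x≈-x (- 1#)) (-‿involutive 1#)

    0<⟦1+n⟧ : ∀ n → 0# < ⟦ suc n ⟧
    0<⟦1+n⟧ zero    = <.<-respʳ-≈ (sym (×-homo-1 1#)) 0<1
    0<⟦1+n⟧ (suc n) = <.trans (0<⟦1+n⟧ n)
      (<.<-respˡ-≈ (+-identityˡ _) (+-monoˡ-< ⟦ suc n ⟧ 0<1))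

    invertible : ∀ n → ∃[ y ] ⟦ suc n ⟧ * y ≈ 1#
    invertible n with #⇒invertible (#-sym (<⇒# (0<⟦1+n⟧ n)))
    ... | y , _ , inv = y , trans (*-congʳ (sym (x-0≈x _))) inv

  infixl 7 _/_
  _/_ : Carrier → (n : ℕ) → .{{_ : NonZero n}} → Carrier
  x / suc n = x * proj₁ (invertible n)

  n*[x/n]≈x : ∀ x n .{{_ : NonZero n}} → ⟦ n ⟧ * (x / n) ≈ x
  n*[x/n]≈x x (suc n) = begin
    ⟦ suc n ⟧ * (x * y)  ≈⟨ *-congˡ (*-comm x y) ⟩
    ⟦ suc n ⟧ * (y * x)  ≈⟨ *-assoc _ y x ⟨
    ⟦ suc n ⟧ * y * x    ≈⟨ *-congʳ (proj₂ (invertible n)) ⟩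
    1# * x               ≈⟨ *-identityˡ x ⟩
    x                    ∎
    where y = proj₁ (invertible n)

  _/_! : Carrier → ℕ → Carrier
  x / n ! = (x / (n ℕ.!)) {{n !≢0}}

  record TaggedPartition (lo hi : Carrier) : Set (a ⊔ ℓ₁ ⊔ ℓ₃) where
    field
      size    : ℕ
      point   : Fin (suc size) → Carrier
      tag     : Fin size → Carrier
      first   : point zero ≈ lo
      last    : point (fromℕ size) ≈ hi
      point≤tag : ∀ i → point (inject₁ i) ≤ tag i
      tag≤point : ∀ i → tag i ≤ point (suc i)

    width : Fin size → Carrier
    width i = point (suc i) - point (inject₁ i)

    riemannSum : (Carrier → Carrier) → Carrier
    riemannSum f = sum (λ i → f (tag i) * width i)

  -- The Riemann integral of f over [lo , hi] exists and equals I.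
  Integral : Carrier → Carrier → (Carrier → Carrier) → Carrier → Set (a ⊔ ℓ₁ ⊔ ℓ₃)
  Integral lo hi f I =
    ∀ ε → 0# < ε → ∃[ δ ] 0# < δ ×
      (∀ (P : TaggedPartition lo hi) → let open TaggedPartition P in
        (∀ i → width i < δ) → Within ε (riemannSum f) I)

  binom : Carrier → ℕ → Carrier
  binom z n = product {n} (λ i → z - ⟦ toℕ i ⟧) / n !

  -- Integral is a relation, so the polynomials are given as functions together with
  -- witnesses of their defining equations.  Inhabiting this record amounts to showing
  -- that the integrands are integrable.
  record CauchyPolynomials : Set (a ⊔ ℓ₁ ⊔ ℓ₃) where
    field
      c ĉ   : ℕ → Carrier → Carrier
      c-def : ∀ n x → ∃[ I ] Integral 0# 1# (λ t → binom (t - x) n) I × c n x ≈ ⟦ n ℕ.! ⟧ * I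
      ĉ-def : ∀ n x → ∃[ I ] Integral 0# 1# (λ t → binom (x - t) n) I × ĉ n x ≈ ⟦ n ℕ.! ⟧ * I

    cauchyNumber₁ : ℕ → Carrier
    cauchyNumber₁ n = c n 0#

  -- Formal power series as coefficient sequences.
  Series : Set a
  Series = ℕ → Carrier

  infixl 7 _⊛_
  _⊛_ : Series → Series → Series
  (f ⊛ g) n = sum {suc n} (λ i → f (toℕ i) * g (n ∸ toℕ i))

  egf : Series → Series
  egf s n = s n / n !

  -- eᵗ - 1
  expm1 : Series
  expm1 zero    = 0#
  expm1 (suc n) = 1# / suc n !

  δ : ℕ → ℕ → Carrier
  δ m n = if ⌊ m ≟ n ⌋ then 1# else 0#

  -- The coefficients of tⁿ, …, t⁰ in t / (eᵗ - 1), obtained by long division.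
  quotient : (n : ℕ) → Vec Carrier (suc n)
  quotient zero    = 1# ∷ []
  quotient (suc n) =
    - sum {suc n} (λ i → expm1 (suc (suc (toℕ i))) * lookup (quotient n) i) ∷ quotient n

  t/[eᵗ-1] : Series
  t/[eᵗ-1] n = head (quotient n)

  B : ℕ → Carrier
  B m = ⟦ m ℕ.! ⟧ * t/[eᵗ-1] m

  private
    n!*x/n!≈x : ∀ n x → (⟦ n ℕ.! ⟧ * x) / n ! ≈ x
    n!*x/n!≈x n x with n ℕ.! | n !≢0
    ... | suc k | _ = begin
      ⟦ suc k ⟧ * x * y    ≈⟨ *-assoc _ x y ⟩
      ⟦ suc k ⟧ * (x * y)  ≈⟨ n*[x/n]≈x x (suc k) ⟩
      x                    ∎
      where y = proj₁ (invertible k)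

    lookup-quotient : ∀ n i → lookup (quotient n) i ≡ t/[eᵗ-1] (n ∸ toℕ i)
    lookup-quotient zero    zero    = ≡.refl
    lookup-quotient (suc n) zero    = ≡.refl
    lookup-quotient (suc n) (suc i) = lookup-quotient n i

    1/1!≈1 : 1# / 1 ! ≈ 1#
    1/1!≈1 = trans (sym (trans (*-congʳ (×-homo-1 1#)) (*-identityˡ _))) (n*[x/n]≈x 1# 1)

    expm1⊛quotient : ∀ n → (expm1 ⊛ t/[eᵗ-1]) n ≈ δ n 1
    expm1⊛quotient zero = trans (+-identityʳ _) (zeroˡ _)
    expm1⊛quotient (suc zero) = begin
      0# * _ + (1# / 1 ! * 1# + 0#)  ≈⟨ +-cong (zeroˡ _) (+-identityʳ _) ⟩
      0# + 1# / 1 ! * 1#             ≈⟨ +-identityˡ _ ⟩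
      1# / 1 ! * 1#                  ≈⟨ *-identityʳ _ ⟩
      1# / 1 !                       ≈⟨ 1/1!≈1 ⟩
      1#                             ∎
    expm1⊛quotient (suc (suc n)) = begin
      0# * _ + (1# / 1 ! * - S + S′)  ≈⟨ +-cong (zeroˡ _) (+-cong (*-congʳ 1/1!≈1) S′≈S) ⟩
      0# + (1# * - S + S)             ≈⟨ +-identityˡ _ ⟩
      1# * - S + S                    ≈⟨ +-congʳ (*-identityˡ _) ⟩
      - S + S                         ≈⟨ -‿inverseˡ S ⟩
      0#                              ∎
      where
      S S′ : Carrier
      S  = sum {suc n} (λ i → expm1 (suc (suc (toℕ i))) * lookup (quotient n) i)
      S′ = sum {suc n} (λ i → expm1 (suc (suc (toℕ i))) * t/[eᵗ-1] (n ∸ toℕ i))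
      S′≈S : S′ ≈ S
      S′≈S = sum-cong-≋ {suc n} (λ i →
        *-congˡ {expm1 (suc (suc (toℕ i)))} (reflexive (≡.sym (lookup-quotient n i))))

  -- (eᵗ - 1) ∑ Bₘ tᵐ / m! = t
  expm1⊛egf-B : ∀ n → (expm1 ⊛ egf B) n ≈ δ n 1
  expm1⊛egf-B n = trans
    (sum-cong-≋ {suc n} (λ i →
      *-congˡ {expm1 (toℕ i)} (n!*x/n!≈x (n ∸ toℕ i) (t/[eᵗ-1] (n ∸ toℕ i)))))
    (expm1⊛quotient n)

  infixl 6 ∑₁
  ∑₁ : (n : ℕ) → ((m : ℕ) → .{{_ : NonZero m}} → Carrier) → Carrier
  ∑₁ n f = sum {n} (λ i → f (suc (toℕ i)))

  syntax ∑₁ n (λ m → x) = ∑[1≤ m ≤ n ] x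

  module _ (C : CauchyPolynomials) (n : ℕ) where
    open CauchyPolynomials C

    Formula-c : Carrier → Set ℓ₁
    Formula-c x =
      c n x ≈ cauchyNumber₁ n + (- 1#) ^ n * ⟦ n ⟧ *
        (∑[1≤ m ≤ n ] (1# / m * ⟦ stirling₁ (n ∸ 1) (m ∸ 1) ⟧ * x ^ m))

    Formula-ĉ : Carrier → Set ℓ₁
    Formula-ĉ x =
      ĉ n x ≈ cauchyNumber₁ n + (- 1#) ^ n * ⟦ n ⟧ *
        (∑[1≤ m ≤ n ] ((- 1#) ^ m / m * ⟦ stirling₁ (n ∸ 1) (m ∸ 1) ⟧ * (x - 1#) ^ m))

    Formula-cauchyNumber₁ : Set ℓ₁
    Formula-cauchyNumber₁ =
      cauchyNumber₁ n ≈ δ n 1 + (- 1#) ^ (n ℕ.+ 1) * ⟦ n ⟧ *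
        (∑[1≤ m ≤ n ] (⟦ stirling₁ (n ∸ 1) (m ∸ 1) ⟧ * (B m / m)))

{-# OPTIONS --safe #-}

-- Encode a polynomial ∑ pₖ zᵏ by a linear functional zᵏ ↦ b k evaluated on it. With the
-- functional p ↦ ∫₀ˣ p, the falling factorial (z)ₙ gives Φₙ(x) = ∫₀ˣ (t)ₙ dt, and
-- cₙ(x) = Φₙ(1 - x) - Φₙ(- x), ĉₙ(x) = Φₙ(x) - Φₙ(x - 1). The identity
-- (z + 1)ₙ = (z)ₙ + n (z)ₙ₋₁, read through that functional, is
-- Φₙ(1 + z) - Φₙ(z) = Φₙ(1) + n Φₙ₋₁(z), which yields the first two formulas. Read through
-- zᵏ ↦ (-1)ᵏ⁺¹ Bₖ₊₁ / (k + 1), where z ↦ 1 + z adds ∫₀¹ (1 - tᵏ) dt to the value at zᵏ,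
-- it yields the third.

module Submission where

open import Defs
open import Algebra.Bundles using (CommutativeRing; RawRing; Semiring)
open import Algebra.Definitions using (Invertible)
open import Algebra.Solver.Ring.AlmostCommutativeRing
  using (fromCommutativeRing; _-Raw-AlmostCommutative⟶_; Induced-equivalence)
open import Data.Fin.Base using (Fin; zero; suc; toℕ; inject₁; fromℕ)
open import Data.Fin.Properties using (toℕ-inject₁; toℕ-fromℕ)
open import Data.Maybe.Base using (just; nothing)
open import Data.Nat.Base as ℕ using (ℕ; zero; suc; NonZero; _∸_)
import Data.Nat.Properties as ℕ
open import Data.Product.Base using (_×_; _,_; ∃-syntax; proj₁; proj₂)
open import Data.Sum.Base using (_⊎_; inj₁; inj₂; [_,_]′)
open import Function.Base using (id)
open import Level using (_⊔_)
open import Relation.Binary.Definitions using (WeaklyDecidable)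
open import Relation.Binary.PropositionalEquality.Core as ≡ using (_≡_)
open import Relation.Binary.Structures using (IsStrictPartialOrder)
open import Relation.Nullary.Decidable.Core using (yes; no)
open import Relation.Nullary.Negation.Core using (¬_; contradiction)

-- No coefficients of polynomials are stored: multiplication by z, the shift z ↦ 1 + z and
-- integration all act on the sequence of values at the powers of z, so one induction on n serves
-- every functional. The Bernoulli functional is a solution of a difference equation: its change
-- under z ↦ 1 + z is p ↦ p(1) minus the integral of p over [0, 1]. For the falling factorial, p(1)
-- yields the Kronecker delta and the integral yields cₙ.
--
-- The analytic obstacle is that equality and order need not be decidable, while `Integral` speaks
-- of all tagged partitions. Antiderivatives therefore carry a uniform bound |F(v) - F(t) - f(t) (v
-- - t)| ≤ N (v - t)², which survives linear combinations and controls every Riemann sum at once.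
-- The formulas are claimed for arbitrary `CauchyPolynomials`, so integrals must also be unique;
-- this is proved by refuting both strict inequalities and appealing to tightness of apartness.

-- A ring solver with integer coefficients for any commutative ring.

-- A pair (m , n) is the integer coefficient m - n.
module IntegerRingSolver {a ℓ} (R : CommutativeRing a ℓ) where

  open CommutativeRing R
  open import Algebra.Definitions.RawSemiring (Semiring.rawSemiring semiring)
    using () renaming (_×_ to _·_; _×′_ to _·′_)
  open import Algebra.Properties.Monoid.Mult.TCOptimised +-monoid using (×ᵤ≈×)
  open import Algebra.Properties.Semiring.Mult semiring using (×-homo-+; ×1-homo-*)
  open import Algebra.Solver.Ring.NaturalCoefficients.Default commutativeSemiring
    as Natural using () renaming (_:+_ to _⊕_; _:*_ to _⊗_; _:=_ to _⊜_)
  open import Relation.Binary.Reasoning.Setoid setoid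

  private
    -- Canonical representatives, with at least one entry zero: equal integers get the same pair, so
    -- the normal forms of equal polynomials coincide definitionally and `refl` closes a `solve`
    -- goal.
    reduce : ℕ → ℕ → ℕ × ℕ
    reduce zero    n       = 0 , n
    reduce (suc m) zero    = suc m , 0
    reduce (suc m) (suc n) = reduce m n

    differences : RawRing _ _
    differences = record
      { Carrier = ℕ × ℕ
      ; _≈_     = _≡_
      ; _+_     = λ (m , n) (p , q) → reduce (m ℕ.+ p) (n ℕ.+ q)
      ; _*_     = λ (m , n) (p , q) → reduce (m ℕ.* p ℕ.+ n ℕ.* q) (m ℕ.* q ℕ.+ n ℕ.* p)
      ; -_      = λ (m , n) → n , m
      ; 0#      = 0 , 0
      ; 1#      = 1 , 0
      }

    -- The special cases make the constants 0 and 1 denote 0# and 1# definitionally.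
    ⟪_⟫ : ℕ × ℕ → Carrier
    ⟪ m , zero ⟫  = m ·′ 1#
    ⟪ m , suc n ⟫ = m ·′ 1# - suc n ·′ 1#

    transpose : ∀ {x y z} → x + y ≈ z → x ≈ z - y
    transpose {x} {y} {z} e = begin
      x              ≈⟨ +-identityʳ x ⟨
      x + 0#         ≈⟨ +-congˡ (-‿inverseʳ y) ⟨
      x + (y - y)    ≈⟨ +-assoc x y (- y) ⟨
      x + y - y      ≈⟨ +-congʳ e ⟩
      z - y          ∎

    restore : ∀ x y → x - y + y ≈ x
    restore x y = begin
      x - y + y      ≈⟨ +-assoc x (- y) y ⟩
      x + (- y + y)  ≈⟨ +-congˡ (-‿inverseˡ y) ⟩
      x + 0#         ≈⟨ +-identityʳ x ⟩
      x              ∎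

    ⟪⟫+n≈m : ∀ m n → ⟪ m , n ⟫ + n · 1# ≈ m · 1#
    ⟪⟫+n≈m m zero    = trans (+-identityʳ _) (sym (×ᵤ≈× m 1#))
    ⟪⟫+n≈m m (suc n) = begin
      m ·′ 1# - suc n ·′ 1# + suc n · 1#  ≈⟨ +-congˡ (×ᵤ≈× (suc n) 1#) ⟩
      m ·′ 1# - suc n ·′ 1# + suc n ·′ 1# ≈⟨ restore _ _ ⟩
      m ·′ 1#                             ≈⟨ ×ᵤ≈× m 1# ⟨
      m · 1#                              ∎

    -- Characterises the value of a pair by an equation without subtraction. The laws for sums and
    -- products thereby become commutative semiring identities, within reach of the solver with
    -- natural coefficients.
    unique : ∀ {x} m n → x + n · 1# ≈ m · 1# → x ≈ ⟪ m , n ⟫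
    unique m n e = trans (transpose e) (sym (transpose (⟪⟫+n≈m m n)))

    reduce-homo : ∀ m n → ⟪ m , n ⟫ ≈ ⟪ reduce m n ⟫
    reduce-homo zero    n       = refl
    reduce-homo (suc m) zero    = refl
    reduce-homo (suc m) (suc n) = begin
      ⟪ suc m , suc n ⟫         ≈⟨ transpose (⟪⟫+n≈m (suc m) (suc n)) ⟩
      suc m · 1# - suc n · 1#   ≈⟨ transpose (begin
        ⟪ m , n ⟫ + suc n · 1#
          ≈⟨ Natural.solve 3 (λ x y z → x ⊕ (y ⊕ z) ⊜ y ⊕ (x ⊕ z)) refl _ _ _ ⟩
        1# + (⟪ m , n ⟫ + n · 1#) ≈⟨ +-congˡ (⟪⟫+n≈m m n) ⟩
        suc m · 1#                ∎) ⟨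
      ⟪ m , n ⟫                 ≈⟨ reduce-homo m n ⟩
      ⟪ reduce m n ⟫            ∎

    unique-reduce : ∀ {x} m n → x + n · 1# ≈ m · 1# → x ≈ ⟪ reduce m n ⟫
    unique-reduce m n e = trans (unique m n e) (reduce-homo m n)

    open RawRing differences using () renaming (_+_ to _⊞_; _*_ to _⊠_)

    homo-+ : ∀ p q → ⟪ p ⊞ q ⟫ ≈ ⟪ p ⟫ + ⟪ q ⟫
    homo-+ (m , n) (p , q) = sym (unique-reduce (m ℕ.+ p) (n ℕ.+ q) (begin
      ⟪ m , n ⟫ + ⟪ p , q ⟫ + (n ℕ.+ q) · 1#           ≈⟨ +-congˡ (×-homo-+ 1# n q) ⟩
      ⟪ m , n ⟫ + ⟪ p , q ⟫ + (n · 1# + q · 1#)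
        ≈⟨ Natural.solve 4 (λ x y z w → x ⊕ y ⊕ (z ⊕ w) ⊜ (x ⊕ z) ⊕ (y ⊕ w)) refl _ _ _ _ ⟩
      (⟪ m , n ⟫ + n · 1#) + (⟪ p , q ⟫ + q · 1#)      ≈⟨ +-cong (⟪⟫+n≈m m n) (⟪⟫+n≈m p q) ⟩
      m · 1# + p · 1#                                  ≈⟨ ×-homo-+ 1# m p ⟨
      (m ℕ.+ p) · 1#                                   ∎))

    ·-homo : ∀ a b c d → (a ℕ.* b ℕ.+ c ℕ.* d) · 1# ≈ a · 1# * b · 1# + c · 1# * d · 1#
    ·-homo a b c d = trans (×-homo-+ 1# (a ℕ.* b) (c ℕ.* d)) (+-cong (×1-homo-* a b) (×1-homo-* c d))

    homo-* : ∀ p q → ⟪ p ⊠ q ⟫ ≈ ⟪ p ⟫ * ⟪ q ⟫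
    homo-* (m , n) (p , q) = sym (unique-reduce (m ℕ.* p ℕ.+ n ℕ.* q) (m ℕ.* q ℕ.+ n ℕ.* p) (begin
      x * y + (m ℕ.* q ℕ.+ n ℕ.* p) · 1#     ≈⟨ +-congˡ (·-homo m q n p) ⟩
      x * y + (m · 1# * Q + N * p · 1#)
        ≈⟨ +-congˡ (+-cong (*-congʳ (⟪⟫+n≈m m n)) (*-congˡ (⟪⟫+n≈m p q))) ⟨
      x * y + ((x + N) * Q + N * (y + Q))    ≈⟨ Natural.solve 4 (λ x y N Q →
                                                  x ⊗ y ⊕ ((x ⊕ N) ⊗ Q ⊕ N ⊗ (y ⊕ Q)) ⊜ (x ⊕ N) ⊗ (y ⊕ Q) ⊕ N ⊗ Q) refl x y N Q ⟩
      (x + N) * (y + Q) + N * Q              ≈⟨ +-congʳ (*-cong (⟪⟫+n≈m m n) (⟪⟫+n≈m p q)) ⟩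
      m · 1# * p · 1# + N * Q                ≈⟨ ·-homo m p n q ⟨
      (m ℕ.* p ℕ.+ n ℕ.* q) · 1#             ∎))
      where
      x = ⟪ m , n ⟫
      y = ⟪ p , q ⟫
      N = n · 1#
      Q = q · 1#

    homo-- : ∀ m n → ⟪ n , m ⟫ ≈ - ⟪ m , n ⟫
    homo-- m n = begin
      ⟪ n , m ⟫                            ≈⟨ transpose (⟪⟫+n≈m n m) ⟩
      n · 1# - m · 1#                      ≈⟨ +-cong (+-identityˡ _) (-‿cong (⟪⟫+n≈m m n)) ⟨
      0# + n · 1# - (x + n · 1#)           ≈⟨ transpose (begin
         - x + (x + n · 1#)                  ≈⟨ +-assoc _ _ _ ⟨
         - x + x + n · 1#                    ≈⟨ +-congʳ (-‿inverseˡ x) ⟩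
         0# + n · 1#                         ∎) ⟨
      - x                                  ∎
      where x = ⟪ m , n ⟫

    morphism : differences -Raw-AlmostCommutative⟶ fromCommutativeRing R
    morphism = record
      { ⟦_⟧    = ⟪_⟫
      ; +-homo = homo-+
      ; *-homo = homo-*
      ; -‿homo = λ (m , n) → homo-- m n
      ; 0-homo = refl
      ; 1-homo = refl
      }

    _≟_ : WeaklyDecidable (Induced-equivalence morphism)
    (m , n) ≟ (p , q) with m ℕ.+ q ℕ.≟ p ℕ.+ n
    ... | no  _ = nothing
    ... | yes e = just (unique p q (begin
      ⟪ m , n ⟫ + q · 1#                    ≈⟨ transpose (begin
        ⟪ m , n ⟫ + q · 1# + n · 1#
          ≈⟨ Natural.solve 3 (λ x y z → x ⊕ y ⊕ z ⊜ x ⊕ z ⊕ y) refl _ _ _ ⟩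
        ⟪ m , n ⟫ + n · 1# + q · 1#           ≈⟨ +-congʳ (⟪⟫+n≈m m n) ⟩
        m · 1# + q · 1#                       ≈⟨ ×-homo-+ 1# m q ⟨
        (m ℕ.+ q) · 1#                        ≡⟨ ≡.cong (_· 1#) e ⟩
        (p ℕ.+ n) · 1#                        ≈⟨ ×-homo-+ 1# p n ⟩
        p · 1# + n · 1#                       ∎) ⟩
      p · 1# + n · 1# - n · 1#              ≈⟨ transpose refl ⟨
      p · 1#                                ∎))

  open import Algebra.Solver.Ring differences (fromCommutativeRing R) morphism _≟_ public
    using (Polynomial; solve; con; _:+_; _:*_; _:-_; :-_; _:=_)

  :0 :1 : ∀ {n} → Polynomial n
  :0 = con (0 , 0)
  :1 = con (1 , 0)

-- Umbral calculus: linear functionals on polynomials as sequences.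

module Umbral {a ℓ} (R : CommutativeRing a ℓ) where

  open CommutativeRing R hiding (zero)
  open import Algebra.Definitions.RawSemiring (Semiring.rawSemiring semiring)
    using (_^_; sum; product) renaming (_×_ to _·_)
  open import Algebra.Properties.Semiring.Mult semiring using (×-homo-+; ×1-homo-*)
  open import Algebra.Properties.Semiring.Sum semiring
    using (sum-cong-≋; *-distribˡ-sum; ∑-distrib-+; sum-replicate-zero)
  open import Relation.Binary.Reasoning.Setoid setoid
  open IntegerRingSolver R

  ⟦_⟧ : ℕ → Carrier
  ⟦ n ⟧ = n · 1#

  Sequence : Set a
  Sequence = ℕ → Carrier

  infix 4 _≐_
  _≐_ : Sequence → Sequence → Set ℓ
  b ≐ c = ∀ k → b k ≈ c k

  -- As a functional: evaluation at z.
  powers : Carrier → Sequence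
  powers z k = z ^ k

  infixl 6 _⊕_
  _⊕_ : Sequence → Sequence → Sequence
  (b ⊕ c) k = b k + c k

  infixl 7 _⊙_
  _⊙_ : Carrier → Sequence → Sequence
  (x ⊙ b) k = x * b k

  -- As a functional: multiply the polynomial by z, then apply b.
  shift : Sequence → Sequence
  shift b k = b (suc k)

  -- The linear functional zᵏ ↦ b k applied to z (z - 1) ⋯ (z - n + 1).
  fall : ℕ → Sequence → Carrier
  fall zero    b = b 0
  fall (suc n) b = fall n (shift b) - ⟦ n ⟧ * fall n b

  -- The linear functional zᵏ ↦ b k applied to (1 + z)ᵏ.
  translate : Sequence → Sequence
  translate b zero    = b 0
  translate b (suc k) = translate (b ⊕ shift b) k

  alternate : Sequence → Sequence
  alternate b k = (- 1#) ^ k * b k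

  fall-cong : ∀ n {b c} → b ≐ c → fall n b ≈ fall n c
  fall-cong zero    e = e 0
  fall-cong (suc n) e =
    +-cong (fall-cong n (λ k → e (suc k))) (-‿cong (*-congˡ (fall-cong n e)))

  fall-⊕ : ∀ n b c → fall n (b ⊕ c) ≈ fall n b + fall n c
  fall-⊕ zero    b c = refl
  fall-⊕ (suc n) b c = trans
    (+-cong (fall-⊕ n (shift b) (shift c)) (-‿cong (*-congˡ (fall-⊕ n b c))))
    (solve 5 (λ p q N r s → (p :+ q) :- N :* (r :+ s) := (p :- N :* r) :+ (q :- N :* s))
      refl _ _ _ _ _)

  fall-⊙ : ∀ n x b → fall n (x ⊙ b) ≈ x * fall n b
  fall-⊙ zero    x b = refl
  fall-⊙ (suc n) x b = trans
    (+-cong (fall-⊙ n x (shift b)) (-‿cong (*-congˡ (fall-⊙ n x b))))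
    (solve 4 (λ x p N r → x :* p :- N :* (x :* r) := x :* (p :- N :* r)) refl _ _ _ _)

  translate-cong : ∀ {b c} → b ≐ c → translate b ≐ translate c
  translate-cong e zero    = e 0
  translate-cong e (suc k) = translate-cong (λ i → +-cong (e i) (e (suc i))) k

  translate-⊕ : ∀ b c → translate (b ⊕ c) ≐ translate b ⊕ translate c
  translate-⊕ b c zero    = refl
  translate-⊕ b c (suc k) = trans
    (translate-cong (λ i → solve 4 (λ p q r s → (p :+ q) :+ (r :+ s) := (p :+ r) :+ (q :+ s))
      refl _ _ _ _) k)
    (translate-⊕ (b ⊕ shift b) (c ⊕ shift c) k)

  translate-⊙ : ∀ x b → translate (x ⊙ b) ≐ x ⊙ translate b
  translate-⊙ x b zero    = refl
  translate-⊙ x b (suc k) = trans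
    (translate-cong (λ i → sym (distribˡ x _ _)) k) (translate-⊙ x (b ⊕ shift b) k)

  fall-powers : ∀ n z → fall (suc n) (powers z) ≈ (z - ⟦ n ⟧) * fall n (powers z)
  -- Evaluation is multiplicative: `shift (powers z)` is definitionally `z ⊙ powers z`.
  fall-powers n z = trans (+-congʳ (fall-⊙ n z (powers z)))
    (solve 3 (λ z N p → z :* p :- N :* p := (z :- N) :* p) refl _ _ _)

  -- Bridges two recursions: `product` unfolds at its first factor, `fall` at its last.
  product-snoc : ∀ n (g : Sequence) →
    product {suc n} (λ i → g (toℕ i)) ≈ product {n} (λ i → g (toℕ i)) * g n
  product-snoc zero    g = *-comm _ _
  product-snoc (suc n) g =
    trans (*-congˡ (product-snoc n (shift g))) (sym (*-assoc _ _ _))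

  product≈fall : ∀ n z → product {n} (λ i → z - ⟦ toℕ i ⟧) ≈ fall n (powers z)
  product≈fall zero    z = refl
  product≈fall (suc n) z = begin
    product {suc n} (λ i → z - ⟦ toℕ i ⟧)          ≈⟨ product-snoc n (λ i → z - ⟦ i ⟧) ⟩
    product {n} (λ i → z - ⟦ toℕ i ⟧) * (z - ⟦ n ⟧) ≈⟨ *-congʳ (product≈fall n z) ⟩
    fall n (powers z) * (z - ⟦ n ⟧)                ≈⟨ *-comm _ _ ⟩
    (z - ⟦ n ⟧) * fall n (powers z)                ≈⟨ fall-powers n z ⟨
    fall (suc n) (powers z)                        ∎

  -- As soon as there are two factors, 1 - 1 is one of them. This is the origin of the Kronecker
  -- delta in the third formula.
  fall-powers-1 : ∀ n → fall (suc (suc n)) (powers 1#) ≈ 0#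
  fall-powers-1 zero    = solve 0 ((:1 :* (:1 :* :1) :- :0 :* (:1 :* :1)) :- (:1 :+ :0) :* (:1 :* :1 :- :0 :* :1) := :0) refl
  fall-powers-1 (suc n) =
    trans (fall-powers (suc (suc n)) 1#) (trans (*-congˡ (fall-powers-1 n)) (zeroʳ _))

  -- (z + 1) z ⋯ (z - n + 1) = z (z - 1) ⋯ (z - n) + (n + 1) z (z - 1) ⋯ (z - n + 1)
  fall-translate : ∀ n b → fall (suc n) (translate b) ≈ fall (suc n) b + ⟦ suc n ⟧ * fall n b
  fall-translate zero    b = solve 2 (λ x y →
    x :+ y :- :0 :* x := (y :- :0 :* x) :+ (:1 :+ :0) :* x) refl _ _
  fall-translate (suc n) b = begin
    -- By definition `shift (translate b)` is `translate (b ⊕ shift b)`, so the induction hypothesis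
    -- is used for both b and `shift b`.
    fall (suc n) (translate (b ⊕ shift b)) - N+1 * fall (suc n) (translate b)
      ≈⟨ +-cong (trans (fall-cong (suc n) (translate-⊕ b (shift b)))
                       (fall-⊕ (suc n) (translate b) (translate (shift b))))
                (-‿cong (*-congˡ (fall-translate n b))) ⟩
    fall (suc n) (translate b) + fall (suc n) (translate (shift b)) - N+1 * (p′ + N+1 * p)
      ≈⟨ +-congʳ (+-cong (fall-translate n b) (fall-translate n (shift b))) ⟩
    p′ + N+1 * p + (q + N+1 * fall n (shift b)) - N+1 * (p′ + N+1 * p)
      ≈⟨ solve 4 (λ N p q r → let M = :1 :+ N; p′ = r :- N :* p in
           p′ :+ M :* p :+ (q :+ M :* r) :- M :* (p′ :+ M :* p)
           := (q :- M :* p′) :+ (:1 :+ M) :* p′) refl ⟦ n ⟧ p q (fall n (shift b)) ⟩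
    q - N+1 * p′ + ⟦ suc (suc n) ⟧ * p′ ∎
    where
    N+1 = ⟦ suc n ⟧
    p   = fall n b
    p′  = fall (suc n) b
    q   = fall (suc n) (shift b)

  -- If b represents p ↦ ∫₀ᶻ p, and a represents evaluation at z, this is
  -- ∫₀ᶻ (1 + t)ᵏ dt = ((1 + z)ᵏ⁺¹ - 1) / (k + 1).
  translate-primitive : ∀ {a b} → (∀ k → ⟦ suc k ⟧ * b k ≈ a (suc k)) →
    ∀ k → ⟦ suc k ⟧ * translate b k ≈ translate a (suc k) - a 0
  translate-primitive {a} {b} e zero = begin
    (1# + 0#) * b 0     ≈⟨ e 0 ⟩
    a 1                 ≈⟨ solve 2 (λ x y → y := x :+ y :- x) refl _ _ ⟩
    a 0 + a 1 - a 0     ∎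
  translate-primitive {a} {b} e (suc k) = begin
    (1# + ⟦ suc k ⟧) * translate (b ⊕ shift b) k
      ≈⟨ *-congˡ (translate-⊕ b (shift b) k) ⟩
    (1# + ⟦ suc k ⟧) * (translate b k + translate (shift b) k)
      ≈⟨ solve 3 (λ N x y → (:1 :+ N) :* (x :+ y) := N :* x :+ (x :+ y) :+ N :* y) refl _ _ _ ⟩
    ⟦ suc k ⟧ * translate b k + (translate b k + translate (shift b) k) + ⟦ suc k ⟧ * translate (shift b) k
      ≈⟨ +-cong (+-cong (translate-primitive e k) (sym (translate-⊕ b (shift b) k)))
                (translate-primitive e′ k) ⟩
    translate a (suc k) - a 0 + translate b (suc k) + (translate (shift a ⊕ (- 1#) ⊙ b) (suc k) - (a 1 + - 1# * b 0))
      ≈⟨ +-congˡ (+-cong (trans (translate-⊕ (shift a) ((- 1#) ⊙ b) (suc k))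
                                (+-congˡ (translate-⊙ (- 1#) b (suc k))))
                         (-‿cong (+-congʳ (sym (e 0))))) ⟩
    translate a (suc k) - a 0 + translate b (suc k) + (translate (shift a) (suc k) + - 1# * translate b (suc k) - ((1# + 0#) * b 0 + - 1# * b 0))
      ≈⟨ solve 5 (λ A a₀ B A′ b₀ → A :- a₀ :+ B :+ (A′ :+ (:- :1) :* B :- ((:1 :+ :0) :* b₀ :+ (:- :1) :* b₀))
           := A :+ A′ :- a₀) refl _ _ _ _ _ ⟩
    translate a (suc k) + translate (shift a) (suc k) - a 0
      ≈⟨ +-congʳ (translate-⊕ a (shift a) (suc k)) ⟨
    translate a (suc (suc k)) - a 0 ∎
    where
    -- Integration by parts: `shift b` satisfies the same hypothesis once b is subtracted from
    -- `shift a`.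
    e′ : ∀ k → ⟦ suc k ⟧ * b (suc k) ≈ a (suc (suc k)) + - 1# * b (suc k)
    e′ k = begin
      ⟦ suc k ⟧ * b (suc k)
        ≈⟨ solve 2 (λ N x → N :* x := (:1 :+ N) :* x :+ (:- :1) :* x) refl _ _ ⟩
      ⟦ suc (suc k) ⟧ * b (suc k) + - 1# * b (suc k) ≈⟨ +-congʳ (e (suc k)) ⟩
      a (suc (suc k)) + - 1# * b (suc k)           ∎

  translate-powers : ∀ z → translate (powers z) ≐ powers (1# + z)
  translate-powers z zero    = refl
  translate-powers z (suc k) = begin
    translate (powers z ⊕ shift (powers z)) k
      ≈⟨ translate-cong (λ i → solve 2 (λ z x → x :+ z :* x := (:1 :+ z) :* x) refl _ _) k ⟩
    translate ((1# + z) ⊙ powers z) k         ≈⟨ translate-⊙ (1# + z) (powers z) k ⟩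
    (1# + z) * translate (powers z) k         ≈⟨ *-congˡ (translate-powers z k) ⟩
    (1# + z) * (1# + z) ^ k                   ∎

  -- A functional that vanishes on z², z³, ... sees only the coefficients 1 and k of (1 + z)ᵏ.
  translate-affine : ∀ {b} → (∀ k → b (suc (suc k)) ≈ 0#) →
    ∀ k → translate b k ≈ b 0 + ⟦ k ⟧ * b 1
  translate-affine {b} e zero    = solve 2 (λ x y → x := x :+ :0 :* y) refl _ _
  translate-affine {b} e (suc k) = begin
    translate (b ⊕ shift b) k
      ≈⟨ translate-affine (λ i → trans (+-cong (e i) (e (suc i))) (+-identityʳ _)) k ⟩
    b 0 + b 1 + ⟦ k ⟧ * (b 1 + b 2)    ≈⟨ +-congˡ (*-congˡ (+-congˡ (e 0))) ⟩
    b 0 + b 1 + ⟦ k ⟧ * (b 1 + 0#)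
      ≈⟨ solve 3 (λ x y N → x :+ y :+ N :* (y :+ :0) := x :+ (:1 :+ N) :* y) refl _ _ _ ⟩
    b 0 + ⟦ suc k ⟧ * b 1              ∎

  alternate-⊕ : ∀ b c → alternate (b ⊕ c) ≐ alternate b ⊕ alternate c
  alternate-⊕ b c k = distribˡ _ _ _

  -- Substituting z ↦ - z conjugates z ↦ 1 + z into its inverse.
  translate-alternate-translate : ∀ b → translate (alternate (translate b)) ≐ alternate b
  translate-alternate-translate b zero    = refl
  translate-alternate-translate b (suc k) = begin
    translate (alternate (translate b) ⊕ shift (alternate (translate b))) k
      ≈⟨ translate-cong (λ i → trans (+-congˡ (*-congˡ (translate-⊕ b (shift b) i)))
           (solve 3 (λ s x y → s :* x :+ (:- :1) :* s :* (x :+ y) := (:- :1) :* (s :* y))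
                refl _ _ _)) k ⟩
    translate ((- 1#) ⊙ alternate (translate (shift b))) k
      ≈⟨ translate-⊙ (- 1#) _ k ⟩
    - 1# * translate (alternate (translate (shift b))) k
      ≈⟨ *-congˡ (translate-alternate-translate (shift b) k) ⟩
    - 1# * ((- 1#) ^ k * b (suc k))
      ≈⟨ *-assoc _ _ _ ⟨
    (- 1#) ^ suc k * b (suc k) ∎

  -- Meant for b = `B`, with c the Kronecker delta at 1. Write T for `translate` and A for
  -- `alternate`. Then T A T = A turns T b = b + c into A b = T A b + T A c. The sequence A c is - 1
  -- at index 1 and 0 elsewhere, so T A c is - k at index k.
  translate-alternate : ∀ {b c} → translate b ≐ b ⊕ c → c 0 ≈ 0# → c 1 ≈ 1# →
    (∀ k → c (suc (suc k)) ≈ 0#) →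
    ∀ k → translate (alternate b) k ≈ alternate b k + ⟦ k ⟧
  translate-alternate {b} {c} e c₀ c₁ c₂ k = begin
    X
      ≈⟨ solve 2 (λ x y → x := x :+ (:0 :+ y :* ((:- :1) :* :1 :* :1)) :+ y) refl X ⟦ k ⟧ ⟩
    X + (0# + ⟦ k ⟧ * (- 1# * 1# * 1#)) + ⟦ k ⟧
      ≈⟨ +-congʳ (+-congˡ (+-cong (sym (trans (*-identityˡ _) c₀)) (*-congˡ (*-congˡ (sym c₁))))) ⟩
    X + (alternate c 0 + ⟦ k ⟧ * alternate c 1) + ⟦ k ⟧
      ≈⟨ +-congʳ (+-congˡ (translate-affine (λ i → trans (*-congˡ (c₂ i)) (zeroʳ _)) k)) ⟨
    X + translate (alternate c) k + ⟦ k ⟧           ≈⟨ +-congʳ (translate-⊕ _ _ k) ⟨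
    translate (alternate b ⊕ alternate c) k + ⟦ k ⟧
      ≈⟨ +-congʳ (translate-cong (λ i → trans (sym (alternate-⊕ b c i)) (*-congˡ (sym (e i)))) k) ⟩
    translate (alternate (translate b)) k + ⟦ k ⟧   ≈⟨ +-congʳ (translate-alternate-translate b k) ⟩
    alternate b k + ⟦ k ⟧                           ∎
    where X = translate (alternate b) k

  -- Shifting the index loses the term of index 0, which has the factor n [n , 0] = 0.
  stirling₁-fall : ∀ n b {N} → n ℕ.< N →
    sum {N} (λ i → ⟦ stirling₁ n (toℕ i) ⟧ * alternate b (toℕ i)) ≈ (- 1#) ^ n * fall n b
  -- The rising factorial, whose coefficients are the unsigned Stirling numbers, becomes (- 1)ⁿ
  -- times the falling factorial under z ↦ - z; hence `alternate` and the sign.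
  stirling₁-fall zero    b {suc N} _ = begin
    (1# + 0#) * (1# * b 0) + sum {N} (λ i → 0# * alternate b (suc (toℕ i)))
      ≈⟨ +-congˡ (trans (sum-cong-≋ {N} (λ i → zeroˡ (alternate b (suc (toℕ i))))) (sum-replicate-zero N)) ⟩
    (1# + 0#) * (1# * b 0) + 0#
      ≈⟨ solve 1 (λ x → (:1 :+ :0) :* (:1 :* x) :+ :0 := :1 :* x) refl _ ⟩
    1# * b 0 ∎
  stirling₁-fall (suc n) b {suc N} (ℕ.s≤s n<N) = begin
    0# * (1# * b 0) + sum {N} (λ i → ⟦ stirling₁ (suc n) (suc (toℕ i)) ⟧ * alternate b (suc (toℕ i)))
      ≈⟨ +-cong (zeroˡ _) (sum-cong-≋ {N} (λ i → recurrence (toℕ i))) ⟩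
    0# + sum {N} (λ i → ⟦ n ⟧ * s (toℕ i) + - 1# * s′ (toℕ i))
      ≈⟨ +-congˡ (∑-distrib-+ {N} (λ i → ⟦ n ⟧ * s (toℕ i)) (λ i → - 1# * s′ (toℕ i))) ⟩
    0# + (sum {N} (λ i → ⟦ n ⟧ * s (toℕ i)) + sum {N} (λ i → - 1# * s′ (toℕ i)))
      ≈⟨ +-congˡ (+-cong (*-distribˡ-sum {N} ⟦ n ⟧ (λ i → s (toℕ i))) (*-distribˡ-sum {N} (- 1#) (λ i → s′ (toℕ i)))) ⟨
    0# + (⟦ n ⟧ * S + - 1# * sum {N} (λ i → s′ (toℕ i)))
      ≈⟨ solve 3 (λ N S S′ → :0 :+ (N :* S :+ (:- :1) :* S′) := (:0 :+ N :* S) :- S′) refl _ _ _ ⟩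
    0# + ⟦ n ⟧ * S - sum {N} (λ i → s′ (toℕ i))
      ≈⟨ +-congʳ (+-congʳ (n*[n,0]≈0 n (1# * b 0))) ⟨
    ⟦ n ⟧ * (⟦ stirling₁ n 0 ⟧ * (1# * b 0)) + ⟦ n ⟧ * S - sum {N} (λ i → s′ (toℕ i))
      ≈⟨ +-congʳ (distribˡ _ _ _) ⟨
    ⟦ n ⟧ * sum {suc N} (λ i → ⟦ stirling₁ n (toℕ i) ⟧ * alternate b (toℕ i)) - sum {N} (λ i → s′ (toℕ i))
      -- The two uses of the induction hypothesis have different summation bounds, `suc N` and N,
      -- which is why any bound above n is allowed.
      ≈⟨ +-cong (*-congˡ (stirling₁-fall n b (ℕ.m<n⇒m<1+n n<N))) (-‿cong (stirling₁-fall n (shift b) n<N)) ⟩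
    ⟦ n ⟧ * ((- 1#) ^ n * fall n b) - (- 1#) ^ n * fall n (shift b)
      ≈⟨ solve 4 (λ N m p q → N :* (m :* p) :- m :* q := (:- :1) :* m :* (q :- N :* p))
           refl _ _ _ _ ⟩
    (- 1#) ^ suc n * (fall n (shift b) - ⟦ n ⟧ * fall n b) ∎
    where
    s s′ : Sequence
    s  i = ⟦ stirling₁ n (suc i) ⟧ * alternate b (suc i)
    s′ i = ⟦ stirling₁ n i ⟧ * alternate (shift b) i
    S = sum {N} (λ i → s (toℕ i))
    recurrence : ∀ i → ⟦ stirling₁ (suc n) (suc i) ⟧ * alternate b (suc i) ≈ ⟦ n ⟧ * s i + - 1# * s′ i
    recurrence i = begin
      ⟦ n ℕ.* stirling₁ n (suc i) ℕ.+ stirling₁ n i ⟧ * alternate b (suc i)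
        ≈⟨ *-congʳ (trans (×-homo-+ 1# (n ℕ.* stirling₁ n (suc i)) (stirling₁ n i))
                          (+-congʳ (×1-homo-* n (stirling₁ n (suc i))))) ⟩
      (⟦ n ⟧ * ⟦ stirling₁ n (suc i) ⟧ + ⟦ stirling₁ n i ⟧) * (- 1# * (- 1#) ^ i * b (suc i))
        ≈⟨ solve 5 (λ N p q m x → (N :* p :+ q) :* ((:- :1) :* m :* x)
             := N :* (p :* ((:- :1) :* m :* x)) :+ (:- :1) :* (q :* (m :* x))) refl _ _ _ _ _ ⟩
      ⟦ n ⟧ * s i + - 1# * s′ i ∎
    n*[n,0]≈0 : ∀ n x → ⟦ n ⟧ * (⟦ stirling₁ n 0 ⟧ * x) ≈ 0#
    n*[n,0]≈0 zero    x = zeroˡ _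
    n*[n,0]≈0 (suc n) x = trans (*-congˡ (zeroˡ x)) (zeroʳ _)

  -- Formal power series and multiplication by the exponential series.

  infixl 7 _⊛_
  _⊛_ : Sequence → Sequence → Sequence
  (f ⊛ g) n = sum {suc n} (λ i → f (toℕ i) * g (n ∸ toℕ i))

  derivative : Sequence → Sequence
  derivative f n = ⟦ suc n ⟧ * f (suc n)

  ⊛-congˡ : ∀ {f g h} → g ≐ h → f ⊛ g ≐ f ⊛ h
  ⊛-congˡ {f} {g} {h} e n = sum-cong-≋ {suc n} (λ i → *-congˡ {f (toℕ i)} (e (n ∸ toℕ i)))

  ⊛-congʳ : ∀ {f g h} → f ≐ g → f ⊛ h ≐ g ⊛ h
  ⊛-congʳ {f} {g} {h} e n = sum-cong-≋ {suc n} (λ i → *-congʳ {h (n ∸ toℕ i)} (e (toℕ i)))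

  ⊛-distribˡ-⊕ : ∀ f g h → f ⊛ (g ⊕ h) ≐ f ⊛ g ⊕ f ⊛ h
  ⊛-distribˡ-⊕ f g h n = trans
    (sum-cong-≋ {suc n} (λ i → distribˡ (f (toℕ i)) (g (n ∸ toℕ i)) (h (n ∸ toℕ i))))
    (∑-distrib-+ {suc n} (λ i → f (toℕ i) * g (n ∸ toℕ i)) (λ i → f (toℕ i) * h (n ∸ toℕ i)))

  ⊛-distribʳ-⊕ : ∀ f g h → (f ⊕ g) ⊛ h ≐ f ⊛ h ⊕ g ⊛ h
  ⊛-distribʳ-⊕ f g h n = trans
    (sum-cong-≋ {suc n} (λ i → distribʳ (h (n ∸ toℕ i)) (f (toℕ i)) (g (toℕ i))))
    (∑-distrib-+ {suc n} (λ i → f (toℕ i) * h (n ∸ toℕ i)) (λ i → g (toℕ i) * h (n ∸ toℕ i)))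

  leibniz : ∀ f g → derivative (f ⊛ g) ≐ derivative f ⊛ g ⊕ f ⊛ derivative g
  leibniz f g zero    = solve 4 (λ f₀ f₁ g₀ g₁ →
    (:1 :+ :0) :* (f₀ :* g₁ :+ (f₁ :* g₀ :+ :0))
    := ((:1 :+ :0) :* f₁ :* g₀ :+ :0) :+ (f₀ :* ((:1 :+ :0) :* g₁) :+ :0)) refl _ _ _ _
  leibniz f g (suc n) = begin
    -- Splitting off f 0 leaves `shift f ⊛ g` with weight n + 2, of which the induction hypothesis
    -- absorbs n + 1. The spare copy supplies the head term f 1 and what `derivative (shift f)`
    -- lacks to be the tail of `derivative f`.
    (1# + N) * (f 0 * g (suc (suc n)) + (shift f ⊛ g) (suc n))
      ≈⟨ solve 4 (λ N x y z → (:1 :+ N) :* (x :* y :+ z) := x :* ((:1 :+ N) :* y) :+ z :+ N :* z)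
           refl _ _ _ _ ⟩
    f 0 * derivative g (suc n) + (shift f ⊛ g) (suc n) + N * (shift f ⊛ g) (suc n)
      ≈⟨ +-congˡ (leibniz (shift f) g n) ⟩
    f 0 * derivative g (suc n) + (f 1 * g (suc n) + (shift (shift f) ⊛ g) n)
      + ((derivative (shift f) ⊛ g) n + (shift f ⊛ derivative g) n)
      ≈⟨ solve 6 (λ x f₁ y u v w → x :+ (f₁ :* y :+ u) :+ (v :+ w)
           := ((:1 :+ :0) :* f₁ :* y :+ (u :+ v)) :+ (x :+ w)) refl _ _ _ _ _ _ ⟩
    derivative f 0 * g (suc n) + ((shift (shift f) ⊛ g) n + (derivative (shift f) ⊛ g) n)
      + (f ⊛ derivative g) (suc n)
      ≈⟨ +-congʳ (+-congˡ (trans (sym (⊛-distribʳ-⊕ (shift (shift f)) (derivative (shift f)) g n))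
           (⊛-congʳ {h = g} (λ i → solve 2 (λ N x → x :+ N :* x := (:1 :+ N) :* x)
                refl ⟦ suc i ⟧ (f (suc (suc i)))) n))) ⟩
    (derivative f ⊛ g) (suc n) + (f ⊛ derivative g) (suc n) ∎
    where N = ⟦ suc n ⟧

  -- Both sides of the coefficientwise identity ∑ (translate b)ₙ tⁿ / n! = eᵗ ∑ bₙ tⁿ / n!
  -- satisfy the recurrence defining translate, because eᵗ is its own derivative.
  translate-⊛ : ∀ {r} → r 0 ≈ 1# → derivative r ≐ r →
    ∀ b n → translate b n ≈ ⟦ n ℕ.! ⟧ * (r ⊛ (λ k → b k * r k)) n
  translate-⊛ {r} r₀ dr b zero    = begin
    b 0
      ≈⟨ solve 1 (λ x → x := (:1 :+ :0) :* (:1 :* (x :* :1) :+ :0)) refl _ ⟩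
    (1# + 0#) * (1# * (b 0 * 1#) + 0#)    ≈⟨ *-congˡ (+-congʳ (*-cong r₀ (*-congˡ r₀))) ⟨
    (1# + 0#) * (r 0 * (b 0 * r 0) + 0#)  ∎
  translate-⊛ {r} r₀ dr b (suc n) = begin
    translate (b ⊕ shift b) n                            ≈⟨ translate-⊛ r₀ dr (b ⊕ shift b) n ⟩
    ⟦ n ℕ.! ⟧ * (r ⊛ egf (b ⊕ shift b)) n
      ≈⟨ *-congˡ (⊛-congˡ {r} (λ k → distribʳ (r k) (b k) (b (suc k))) n) ⟩
    ⟦ n ℕ.! ⟧ * (r ⊛ (egf b ⊕ egf (shift b))) n
      ≈⟨ *-congˡ (⊛-distribˡ-⊕ r (egf b) (egf (shift b)) n) ⟩
    ⟦ n ℕ.! ⟧ * ((r ⊛ egf b) n + (r ⊛ egf (shift b)) n)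
      ≈⟨ *-congˡ (+-cong (⊛-congʳ {h = egf b} dr n) (⊛-congˡ {r} derivative-egf n)) ⟨
    ⟦ n ℕ.! ⟧ * ((derivative r ⊛ egf b) n + (r ⊛ derivative (egf b)) n)
      ≈⟨ *-congˡ (leibniz r (egf b) n) ⟨
    ⟦ n ℕ.! ⟧ * (⟦ suc n ⟧ * (r ⊛ egf b) (suc n))
      ≈⟨ solve 3 (λ x y z → x :* (y :* z) := y :* x :* z) refl _ _ _ ⟩
    ⟦ suc n ⟧ * ⟦ n ℕ.! ⟧ * (r ⊛ egf b) (suc n)           ≈⟨ *-congʳ (×1-homo-* (suc n) (n ℕ.!)) ⟨
    ⟦ suc n ℕ.! ⟧ * (r ⊛ egf b) (suc n)                   ∎
    where
    egf : Sequence → Sequence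
    egf b k = b k * r k
    derivative-egf : derivative (egf b) ≐ egf (shift b)
    derivative-egf k = trans (solve 3 (λ N x y → N :* (x :* y) := x :* (N :* y))
         refl _ _ _) (*-congˡ (dr k))

-- Constructive ordered-field arithmetic.

module OrderedField {a ℓ₁ ℓ₂ ℓ₃} (ℝ : RealField a ℓ₁ ℓ₂ ℓ₃) where

  open RealField ℝ hiding (zero)
  open Reals ℝ using (_/_; n*[x/n]≈x)
  open import Algebra.Apartness.Properties.HeytingCommutativeRing heytingCommutativeRing
    using (1#0; invertibleˡ⇒#)
  open import Algebra.Properties.Semiring.Mult semiring using (×-homo-+)
  open import Relation.Binary.Reasoning.Setoid setoid
  open IntegerRingSolver commutativeRing
  private module < = IsStrictPartialOrder <-isStrictPartialOrder

  <-resp : ∀ {x y z w} → x ≈ y → z ≈ w → x < z → y < w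
  <-resp x≈y z≈w x<z = <.<-respʳ-≈ z≈w (<.<-respˡ-≈ x≈y x<z)

  -- Stands in for comparing two elements; it is inherited from cotransitivity of apartness.
  <-cotrans : ∀ {x y} → x < y → ∀ z → x < z ⊎ z < y
  <-cotrans x<y z with #-cotrans (<⇒# x<y) z
  ... | inj₁ x#z with #⇒<∨> x#z
  ...   | inj₁ x<z = inj₁ x<z
  ...   | inj₂ z<x = inj₂ (<.trans z<x x<y)
  <-cotrans x<y z | inj₂ z#y with #⇒<∨> z#y
  ...   | inj₁ z<y = inj₂ z<y
  ...   | inj₂ y<z = inj₁ (<.trans x<y y<z)

  <⇒≤ : ∀ {x y} → x < y → x ≤ y
  <⇒≤ = <.asym

  ≤-resp : ∀ {x y z w} → x ≈ y → z ≈ w → x ≤ z → y ≤ w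
  ≤-resp x≈y z≈w x≤z w<y = x≤z (<-resp (sym z≈w) (sym x≈y) w<y)

  ≤-reflexive : ∀ {x y} → x ≈ y → x ≤ y
  ≤-reflexive x≈y = <.irrefl (sym x≈y)

  ≤-<-trans : ∀ {x y z} → x ≤ y → y < z → x < z
  ≤-<-trans {x} x≤y y<z with <-cotrans y<z x
  ... | inj₁ y<x = contradiction y<x x≤y
  ... | inj₂ x<z = x<z

  ≤-trans : ∀ {x y z} → x ≤ y → y ≤ z → x ≤ z
  ≤-trans x≤y y≤z z<x = x≤y (≤-<-trans y≤z z<x)

  0<y-x⇒x<y : ∀ {x y} → 0# < y - x → x < y
  0<y-x⇒x<y {x} {y} p = <-resp (+-identityˡ x)
    (solve 2 (λ x y → y :- x :+ x := y) refl x y) (+-monoˡ-< x p)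

  x<y⇒0<y-x : ∀ {x y} → x < y → 0# < y - x
  x<y⇒0<y-x {x} {y} p = <-resp (-‿inverseʳ x) refl (+-monoˡ-< (- x) p)

  x≤y⇒0≤y-x : ∀ {x y} → x ≤ y → 0# ≤ y - x
  x≤y⇒0≤y-x {x} {y} p q = p (<-resp
    (solve 2 (λ x y → y :- x :+ x := y) refl x y) (+-identityˡ x) (+-monoˡ-< x q))

  0≤-+ : ∀ {x y} → 0# ≤ x → 0# ≤ y → 0# ≤ x + y
  0≤-+ {x} {y} 0≤x 0≤y x+y<0 = 0≤y (≤-<-trans
    (λ x+y<y → 0≤x (<-resp
      (solve 2 (λ x y → x :+ y :- y := x) refl x y) (-‿inverseʳ y) (+-monoˡ-< (- y) x+y<y)))
    x+y<0)

  0≤-+-0< : ∀ {x y} → 0# ≤ x → 0# < y → 0# < x + y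
  0≤-+-0< {x} {y} 0≤x 0<y = ≤-<-trans 0≤x
    (<-resp (+-identityˡ x) (+-comm y x) (+-monoˡ-< x 0<y))

  0≤-double : ∀ {x} → 0# ≤ x + x → 0# ≤ x
  0≤-double {x} 0≤2x x<0 = 0≤2x (<.trans
    (<-resp refl (+-identityˡ x) (+-monoˡ-< x x<0)) x<0)

  ≮∧≯⇒≈ : ∀ {x y} → ¬ (x < y) → ¬ (y < x) → x ≈ y
  ≮∧≯⇒≈ {x} {y} x≮y y≮x = proj₁ (tight x y) λ x#y → [ x≮y , y≮x ]′ (#⇒<∨> x#y)

  -- A negated goal lets the nonnegative factors be treated as either zero or positive.
  0≤-* : ∀ {x y} → 0# ≤ x → 0# ≤ y → 0# ≤ x * y
  0≤-* {x} {y} 0≤x 0≤y xy<0 = x≯0 λ 0<x → y≯0 λ 0<y → <.asym (*-pos 0<x 0<y) xy<0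
    where
    y≯0 : ¬ ¬ (0# < y)
    y≯0 0≮y = <.irrefl (trans (*-congˡ (≮∧≯⇒≈ 0≤y 0≮y)) (zeroʳ x)) xy<0
    x≯0 : ¬ ¬ (0# < x)
    x≯0 0≮x = <.irrefl (trans (*-congʳ (≮∧≯⇒≈ 0≤x 0≮x)) (zeroˡ y)) xy<0

  0<1 : 0# < 1#
  0<1 with #⇒<∨> 1#0
  ... | inj₂ 0<1 = 0<1
  ... | inj₁ 1<0 = contradiction
    (<-resp refl (solve 0 ((:0 :- :1) :* (:0 :- :1) := :1) refl) (*-pos (x<y⇒0<y-x 1<0) (x<y⇒0<y-x 1<0)))
    (<.asym 1<0)

  0≤⟦n⟧ : ∀ n → 0# ≤ ⟦ n ⟧
  0≤⟦n⟧ zero    = ≤-reflexive refl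
  0≤⟦n⟧ (suc n) = 0≤-+ (<⇒≤ 0<1) (0≤⟦n⟧ n)

  0<⟦1+n⟧ : ∀ n → 0# < ⟦ suc n ⟧
  0<⟦1+n⟧ n = <-resp refl (+-comm _ _) (0≤-+-0< (0≤⟦n⟧ n) 0<1)

  *-cancelˡ-#0 : ∀ {x y} → x * y # 0# → y # 0#
  *-cancelˡ-#0 {x} {y} xy#0 = helper (#⇒invertible xy#0)
    where
    helper : Invertible _≈_ 1# _*_ (x * y - 0#) → y # 0#
    helper (z , z*[xy-0]≈1 , _) = invertibleˡ⇒# (z * x , (begin
      z * x * (y - 0#)
        ≈⟨ solve 3 (λ x y z → z :* x :* (y :- :0) := z :* (x :* y :- :0)) refl x y z ⟩
      z * (x * y - 0#)   ≈⟨ z*[xy-0]≈1 ⟩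
      1#                 ∎))

  -- Since x y is invertible, y is apart from 0. Only then is its sign a choice between two cases,
  -- and the negative one is refuted.
  *-cancelˡ-pos : ∀ {x y} → 0# < x → 0# < x * y → 0# < y
  *-cancelˡ-pos {x} {y} 0<x 0<xy = [ impossible , id ]′ (#⇒<∨> (*-cancelˡ-#0 (#-sym (<⇒# 0<xy))))
    where
    impossible : y < 0# → 0# < y
    impossible y<0 = contradiction 0<xy (<.asym (0<y-x⇒x<y
      (<-resp refl (solve 2 (λ x y → x :* (:0 :- y) := :0 :- x :* y)
           refl x y) (*-pos 0<x (x<y⇒0<y-x y<0)))))

  0<x/n : ∀ {x} n → 0# < x → 0# < x / suc n
  0<x/n n 0<x = *-cancelˡ-pos (0<⟦1+n⟧ n) (<-resp refl (sym (n*[x/n]≈x _ (suc n))) 0<x)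

  infix 4 ∣_∣≤_
  -- Two nonnegativity facts in place of an absolute value, so that sums and products of bounds
  -- reduce to `0≤-+` and `0≤-*`.
  ∣_∣≤_ : Carrier → Carrier → Set ℓ₃
  ∣ x ∣≤ y = 0# ≤ y - x × 0# ≤ y + x

  ∣∣≤-resp : ∀ {x x′ y y′} → x ≈ x′ → y ≈ y′ → ∣ x ∣≤ y → ∣ x′ ∣≤ y′
  ∣∣≤-resp x≈ y≈ (p , q) = ≤-resp refl (+-cong y≈ (-‿cong x≈)) p , ≤-resp refl (+-cong y≈ x≈) q

  ∣∣≤-weaken : ∀ {x y z} → ∣ x ∣≤ y → 0# ≤ z - y → ∣ x ∣≤ z
  ∣∣≤-weaken {x} {y} {z} (p , q) r =
      ≤-resp refl (solve 3 (λ x y z → y :- x :+ (z :- y) := z :- x) refl x y z) (0≤-+ p r)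
    , ≤-resp refl (solve 3 (λ x y z → y :+ x :+ (z :- y) := z :+ x) refl x y z) (0≤-+ q r)

  0≤⇒∣∣≤ : ∀ {x} → 0# ≤ x → ∣ x ∣≤ x
  0≤⇒∣∣≤ {x} 0≤x = ≤-reflexive (sym (-‿inverseʳ x)) , 0≤-+ 0≤x 0≤x

  ∣∣≤-+ : ∀ {x y z w} → ∣ x ∣≤ z → ∣ y ∣≤ w → ∣ x + y ∣≤ z + w
  ∣∣≤-+ {x} {y} {z} {w} (p , q) (r , s) =
      ≤-resp refl (solve 4 (λ x y z w → z :- x :+ (w :- y) := z :+ w :- (x :+ y))
           refl x y z w) (0≤-+ p r)
    , ≤-resp refl (solve 4 (λ x y z w → z :+ x :+ (w :+ y) := z :+ w :+ (x :+ y))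
         refl x y z w) (0≤-+ q s)

  ∣∣≤-neg : ∀ {x y} → ∣ x ∣≤ y → ∣ - x ∣≤ y
  ∣∣≤-neg {x} {y} (p , q) =
    ≤-resp refl (solve 2 (λ x y → y :+ x := y :- (:- x)) refl x y) q , p

  -- Twice z w - x y is (z - x) (w + y) + (z + x) (w - y), and similarly for z w + x y; all factors
  -- are nonnegative, so no signs of x and y have to be distinguished.
  ∣∣≤-* : ∀ {x y z w} → ∣ x ∣≤ z → ∣ y ∣≤ w → ∣ x * y ∣≤ z * w
  ∣∣≤-* {x} {y} {z} {w} (p , q) (r , s) =
      0≤-double (≤-resp refl (solve 4 (λ x y z w →
        (z :- x) :* (w :+ y) :+ (z :+ x) :* (w :- y) := (z :* w :- x :* y) :+ (z :* w :- x :* y))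
        refl x y z w) (0≤-+ (0≤-* p s) (0≤-* q r)))
    , 0≤-double (≤-resp refl (solve 4 (λ x y z w →
        (z :+ x) :* (w :+ y) :+ (z :- x) :* (w :- y) := (z :* w :+ x :* y) :+ (z :* w :+ x :* y))
        refl x y z w) (0≤-+ (0≤-* q s) (0≤-* p r)))

  ∣x∣≤⟦n⟧ : ∀ x → ∃[ n ] ∣ x ∣≤ ⟦ n ⟧
  ∣x∣≤⟦n⟧ x with archimedean x | archimedean (- x)
  ... | m , x<m | n , -x<n = m ℕ.+ n , ∣∣≤-resp refl (sym (×-homo-+ 1# m n))
    ( ≤-resp refl (solve 3 (λ x m n → m :- x :+ n := m :+ n :- x) refl x ⟦ m ⟧ ⟦ n ⟧)
        (0≤-+ (<⇒≤ (x<y⇒0<y-x x<m)) (0≤⟦n⟧ n))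
    , ≤-resp refl (solve 3 (λ x m n → m :+ (n :- (:- x)) := m :+ n :+ x) refl x ⟦ m ⟧ ⟦ n ⟧)
        (0≤-+ (0≤⟦n⟧ m) (<⇒≤ (x<y⇒0<y-x -x<n))))

  -- Take n above z = 1 / ε: then ε (n + k + 1 - z) is positive and equals (n + k + 1) (ε - 1 / (n +
  -- k + 1)). The slack k lets the bounds for two different ε be met at a common index.
  1/n<ε : ∀ {ε} → 0# < ε → ∃[ n ] ∀ k → 1# / suc (n ℕ.+ k) < ε
  1/n<ε {ε} 0<ε = helper (#⇒invertible (#-sym (<⇒# 0<ε)))
    where
    module _ (z : Carrier) (z*[ε-0]≈1 : z * (ε - 0#) ≈ 1#) (n k : ℕ) where
      N = ⟦ suc (n ℕ.+ k) ⟧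
      i = 1# / suc (n ℕ.+ k)
      n*[ε-1/n] : ε * (⟦ suc k ⟧ + (⟦ n ⟧ - z)) ≈ N * (ε - i)
      n*[ε-1/n] = begin
        ε * (⟦ suc k ⟧ + (⟦ n ⟧ - z))
          ≈⟨ solve 4 (λ ε k n z → ε :* (:1 :+ k :+ (n :- z)) := (:1 :+ (n :+ k)) :* ε :- z :* (ε :- :0))
               refl ε ⟦ k ⟧ ⟦ n ⟧ z ⟩
        (1# + (⟦ n ⟧ + ⟦ k ⟧)) * ε - z * (ε - 0#)
          ≈⟨ +-cong (*-congʳ (+-congˡ (sym (×-homo-+ 1# n k))))
                    (-‿cong (trans z*[ε-0]≈1 (sym (n*[x/n]≈x 1# (suc (n ℕ.+ k)))))) ⟩
        N * ε - N * i
          ≈⟨ solve 3 (λ N ε y → N :* ε :- N :* y := N :* (ε :- y)) refl N ε i ⟩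
        N * (ε - i) ∎
    helper : Invertible _≈_ 1# _*_ (ε - 0#) → ∃[ n ] ∀ k → 1# / suc (n ℕ.+ k) < ε
    helper (z , z*[ε-0]≈1 , _) with archimedean z
    ... | n , z<n = n , λ k → 0<y-x⇒x<y (*-cancelˡ-pos (0<⟦1+n⟧ (n ℕ.+ k))
      (<-resp refl (n*[ε-1/n] z z*[ε-0]≈1 n k)
        (*-pos 0<ε (0≤-+-0< (0≤⟦n⟧ (suc k)) (x<y⇒0<y-x z<n)))))

  ⟦1+n⟧*-cancelˡ : ∀ n {x y} → ⟦ suc n ⟧ * x ≈ ⟦ suc n ⟧ * y → x ≈ y
  ⟦1+n⟧*-cancelˡ n {x} {y} e = trans (restore x) (trans (*-congˡ e) (sym (restore y)))
    where
    restore : ∀ x → x ≈ 1# / suc n * (⟦ suc n ⟧ * x)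
    restore x = begin
      x                              ≈⟨ *-identityˡ x ⟨
      1# * x                         ≈⟨ *-congʳ (n*[x/n]≈x 1# (suc n)) ⟨
      ⟦ suc n ⟧ * (1# / suc n) * x
        ≈⟨ solve 3 (λ N i x → N :* i :* x := i :* (N :* x)) refl _ _ _ ⟩
      1# / suc n * (⟦ suc n ⟧ * x)   ∎

  /-cong : ∀ n .{{_ : NonZero n}} {x y} → x ≈ y → x / n ≈ y / n
  /-cong (suc n) = *-congʳ

  x/n≈1/n*x : ∀ n .{{_ : NonZero n}} x → x / n ≈ 1# / n * x
  x/n≈1/n*x (suc n) x = solve 2 (λ x i → x :* i := :1 :* i :* x) refl x _

-- Antiderivatives with quadratic Taylor remainder.

module Integration {a ℓ₁ ℓ₂ ℓ₃} (ℝ : RealField a ℓ₁ ℓ₂ ℓ₃) where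

  open RealField ℝ hiding (zero)
  open Reals ℝ hiding (δ; _⊛_)
  open OrderedField ℝ
  open import Algebra.Properties.Semiring.Mult semiring using (×-homo-+; ×1-homo-*; ×-homo-1)
  open import Relation.Binary.Reasoning.Setoid setoid
  open IntegerRingSolver commutativeRing
  open Umbral commutativeRing using (fall)

  InUnit : Carrier → Set ℓ₃
  InUnit t = 0# ≤ t × t ≤ 1#

  -- Two arguments because a Taylor remainder depends on two points; a natural bound because
  -- `fundamental-theorem` divides by its successor.
  Bounded : (Carrier → Carrier → Carrier) → Set (a ⊔ ℓ₃)
  Bounded q = ∃[ n ] ∀ {t v} → InUnit t → InUnit v → ∣ q t v ∣≤ ⟦ n ⟧

  bounded-constant : ∀ x → Bounded (λ _ _ → x)
  bounded-constant x = proj₁ (∣x∣≤⟦n⟧ x) , λ _ _ → proj₂ (∣x∣≤⟦n⟧ x)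

  bounded-swap : ∀ {q} → Bounded q → Bounded (λ t v → q v t)
  bounded-swap (n , p) = n , λ t v → p v t

  bounded-+ : ∀ {q r} → Bounded q → Bounded r → Bounded (λ t v → q t v + r t v)
  bounded-+ (m , p) (n , s) =
    m ℕ.+ n , λ t v → ∣∣≤-resp refl (sym (×-homo-+ 1# m n)) (∣∣≤-+ (p t v) (s t v))

  bounded-* : ∀ {q r} → Bounded q → Bounded r → Bounded (λ t v → q t v * r t v)
  bounded-* (m , p) (n , s) =
    m ℕ.* n , λ t v → ∣∣≤-resp refl (sym (×1-homo-* m n)) (∣∣≤-* (p t v) (s t v))

  bounded-id : Bounded (λ t _ → t)
  bounded-id = 1 , λ {t} (0≤t , t≤1) _ → ∣∣≤-weaken (0≤⇒∣∣≤ 0≤t)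
    (≤-resp refl (+-congʳ (sym (×-homo-1 1#))) (x≤y⇒0≤y-x t≤1))

  -- F′ = f on [0 , 1], with a Taylor remainder that is uniformly quadratic.
  record Primitive (F f : Carrier → Carrier) : Set (a ⊔ ℓ₁ ⊔ ℓ₃) where
    field
      remainder : Carrier → Carrier → Carrier
      bounded   : Bounded remainder
      taylor    : ∀ t v → F v - F t - f t * (v - t) ≈ remainder t v * ((v - t) * (v - t))

  open Primitive

  primitive-cong : ∀ {F f G g} → (∀ t → F t ≈ G t) → (∀ t → f t ≈ g t) →
    Primitive F f → Primitive G g
  primitive-cong F≈G f≈g P = record
    { remainder = remainder P
    ; bounded   = bounded P
    ; taylor    = λ t v → trans
        (+-cong (+-cong (sym (F≈G v)) (-‿cong (sym (F≈G t)))) (-‿cong (*-congʳ (sym (f≈g t)))))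
        (taylor P t v)
    }

  primitive-* : ∀ c {F f} → Primitive F f → Primitive (λ t → c * F t) (λ t → c * f t)
  primitive-* c {F} {f} P = record
    { remainder = λ t v → c * remainder P t v
    ; bounded   = bounded-* (bounded-constant c) (bounded P)
    ; taylor    = λ t v → begin
        c * F v - c * F t - c * f t * (v - t)
          ≈⟨ solve 5 (λ c x y z w → c :* x :- c :* y :- c :* z :* w := c :* (x :- y :- z :* w))
               refl c (F v) (F t) (f t) (v - t) ⟩
        c * (F v - F t - f t * (v - t))
          ≈⟨ *-congˡ (taylor P t v) ⟩
        c * (remainder P t v * ((v - t) * (v - t)))
          ≈⟨ *-assoc _ _ _ ⟨
        c * remainder P t v * ((v - t) * (v - t)) ∎
    }

  primitive-+ : ∀ {F f G g} → Primitive F f → Primitive G g →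
    Primitive (λ t → F t + G t) (λ t → f t + g t)
  primitive-+ {F} {f} {G} {g} P Q = record
    { remainder = λ t v → remainder P t v + remainder Q t v
    ; bounded   = bounded-+ (bounded P) (bounded Q)
    ; taylor    = λ t v → begin
        F v + G v - (F t + G t) - (f t + g t) * (v - t)
          ≈⟨ solve 7 (λ x y z x′ y′ z′ w → x :+ x′ :- (y :+ y′) :- (z :+ z′) :* w
               := (x :- y :- z :* w) :+ (x′ :- y′ :- z′ :* w))
                    refl (F v) (F t) (f t) (G v) (G t) (g t) (v - t) ⟩
        (F v - F t - f t * (v - t)) + (G v - G t - g t * (v - t))
          ≈⟨ +-cong (taylor P t v) (taylor Q t v) ⟩
        remainder P t v * ((v - t) * (v - t)) + remainder Q t v * ((v - t) * (v - t))
          ≈⟨ distribʳ _ _ _ ⟨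
        (remainder P t v + remainder Q t v) * ((v - t) * (v - t)) ∎
    }

  primitive-fall : ∀ n {F f : ℕ → Carrier → Carrier} → (∀ k → Primitive (F k) (f k)) →
    Primitive (λ t → fall n (λ k → F k t)) (λ t → fall n (λ k → f k t))
  primitive-fall zero    P = P 0
  primitive-fall (suc n) P = primitive-cong (λ t → +-*-neg _ _ _) (λ t → +-*-neg _ _ _)
    (primitive-+ (primitive-fall n (λ k → P (suc k))) (primitive-* (- ⟦ n ⟧) (primitive-fall n P)))
    where
    +-*-neg : ∀ x y z → x + - y * z ≈ x - y * z
    +-*-neg = solve 3 (λ x y z → x :+ (:- y) :* z := x :- y :* z) refl

  Affine : (Carrier → Carrier) → Carrier → Set (a ⊔ ℓ₁)
  Affine X α = ∀ t v → X v - X t ≈ α * (v - t)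

  module _ {X : Carrier → Carrier} {α : Carrier} (affine : Affine X α)
           (bounded-X : Bounded (λ t _ → X t)) where

    -- The product rule as a recursion, which keeps predecessors out of the exponents;
    -- `derivative-^≈` gives the closed form.
    derivative-^ : ℕ → Carrier → Carrier
    derivative-^ zero    t = 0#
    derivative-^ (suc k) t = α * X t ^ k + X t * derivative-^ k t

    derivative-^≈ : ∀ k t → derivative-^ (suc k) t ≈ ⟦ suc k ⟧ * (α * X t ^ k)
    derivative-^≈ zero    t =
      solve 2 (λ α x → α :* :1 :+ x :* :0 := (:1 :+ :0) :* (α :* :1)) refl α (X t)
    derivative-^≈ (suc k) t = trans (+-congˡ (*-congˡ (derivative-^≈ k t)))
      (solve 4 (λ α x p N → α :* (x :* p) :+ x :* (N :* (α :* p)) := (:1 :+ N) :* (α :* (x :* p)))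
        refl α (X t) (X t ^ k) ⟦ suc k ⟧)

    bounded-^ : ∀ k → Bounded (λ t _ → X t ^ k)
    bounded-^ zero    = bounded-constant 1#
    bounded-^ (suc k) = bounded-* bounded-X (bounded-^ k)

    bounded-derivative-^ : ∀ k → Bounded (λ t _ → derivative-^ k t)
    bounded-derivative-^ zero    = bounded-constant 0#
    bounded-derivative-^ (suc k) = bounded-+
      (bounded-* (bounded-constant α) (bounded-^ k)) (bounded-* bounded-X (bounded-derivative-^ k))

    primitive-^ : ∀ k → Primitive (λ t → X t ^ k) (derivative-^ k)
    primitive-^ zero    = record
      { remainder = λ _ _ → 0#
      ; bounded   = bounded-constant 0#
      ; taylor    = λ t v → solve 2 (λ w s → :1 :- :1 :- :0 :* w := :0 :* s)
           refl (v - t) ((v - t) * (v - t))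
      }
    primitive-^ (suc k) = record
      -- Product rule for remainders: an affine X has none of its own, so beside X v times the old
      -- remainder only the cross term of the two increments appears.
      { remainder = λ t v → X v * q t v + α * derivative-^ k t
      ; bounded   = bounded-+ (bounded-* (bounded-swap bounded-X) (bounded (primitive-^ k)))
                              (bounded-* (bounded-constant α) (bounded-derivative-^ k))
      ; taylor    = step
      }
      where
      q = remainder (primitive-^ k)
      step : ∀ t v → X v * X v ^ k - X t * X t ^ k - derivative-^ (suc k) t * (v - t)
                     ≈ (X v * q t v + α * derivative-^ k t) * ((v - t) * (v - t))
      step t v = begin
        X v * X v ^ k - X t * X t ^ k - (α * X t ^ k + X t * d) * h
          ≈⟨ solve 7 (λ x y p q α d h → x :* p :- y :* q :- (α :* q :+ y :* d) :* h
               := x :* (p :- q :- d :* h) :+ (x :- y) :* (q :+ d :* h) :- α :* q :* h)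
               refl (X v) (X t) (X v ^ k) (X t ^ k) α d h ⟩
        X v * (X v ^ k - X t ^ k - d * h) + (X v - X t) * (X t ^ k + d * h) - α * X t ^ k * h
          ≈⟨ +-congʳ (+-cong (*-congˡ (taylor (primitive-^ k) t v)) (*-congʳ (affine t v))) ⟩
        X v * (q t v * (h * h)) + α * h * (X t ^ k + d * h) - α * X t ^ k * h
          ≈⟨ solve 6 (λ x r q α d h → x :* (r :* (h :* h)) :+ α :* h :* (q :+ d :* h) :- α :* q :* h
               := (x :* r :+ α :* d) :* (h :* h)) refl (X v) (q t v) (X t ^ k) α d h ⟩
        (X v * q t v + α * d) * (h * h) ∎
        where
        d = derivative-^ k t
        h = v - t

    primitive-powers : ∀ {α′} → α′ * α ≈ 1# → ∀ k →
      Primitive (λ t → α′ * (X t ^ suc k / suc k)) (λ t → X t ^ k)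
    primitive-powers {α′} α′α k = primitive-cong
      (λ t → trans (*-assoc _ _ _) (*-congˡ (sym (x/n≈1/n*x (suc k) (X t ^ suc k)))))
      eq (primitive-* (α′ * (1# / suc k)) (primitive-^ (suc k)))
      where
      eq : ∀ t → α′ * (1# / suc k) * derivative-^ (suc k) t ≈ X t ^ k
      eq t = begin
        α′ * i * derivative-^ (suc k) t         ≈⟨ *-congˡ (derivative-^≈ k t) ⟩
        α′ * i * (⟦ suc k ⟧ * (α * X t ^ k))
          ≈⟨ solve 5 (λ β i N α x → β :* i :* (N :* (α :* x)) := (β :* α) :* (N :* i) :* x)
                                                     refl α′ i ⟦ suc k ⟧ α (X t ^ k) ⟩
        (α′ * α) * (⟦ suc k ⟧ * i) * X t ^ k     ≈⟨ *-congʳ (*-cong α′α (n*[x/n]≈x 1# (suc k))) ⟩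
        1# * 1# * X t ^ k                        ≈⟨ solve 1 (λ x → :1 :* :1 :* x := x) refl _ ⟩
        X t ^ k                                  ∎
        where i = 1# / suc k

  -- The fundamental theorem for Riemann sums.

  module _ {F f : Carrier → Carrier} (P : Primitive F f) where

    private
      q = remainder P
      n = proj₁ (bounded P)

    -- A bare function need not respect the setoid equality; here the Taylor formula with v - t ≈ 0
    -- forces it. The end points of a partition equal 0 and 1 only in that sense.
    F-cong : ∀ {t v} → t ≈ v → F t ≈ F v
    F-cong {t} {v} t≈v = sym (begin
      F v
        ≈⟨ solve 4 (λ x y z w → x := y :+ (x :- y :- z :* w) :+ z :* w)
             refl (F v) (F t) (f t) (v - t) ⟩
      F t + (F v - F t - f t * (v - t)) + f t * (v - t) ≈⟨ +-congʳ (+-congˡ (taylor P t v)) ⟩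
      F t + q t v * (h * h) + f t * h
        ≈⟨ +-cong (+-congˡ (*-congˡ (*-congʳ h≈0))) (*-congˡ h≈0) ⟩
      F t + q t v * (0# * h) + f t * 0#
        ≈⟨ solve 4 (λ x q h f → x :+ q :* (:0 :* h) :+ f :* :0 := x) refl (F t) (q t v) h (f t) ⟩
      F t                                          ∎)
      where
      h = v - t
      h≈0 : h ≈ 0#
      h≈0 = trans (+-congˡ (-‿cong t≈v)) (-‿inverseʳ v)

    -- Expand at the tag t towards both end points. With x = t - u, y = v - t and w = x + y, the
    -- linear terms cancel and the error is at most n (x² + y²) ≤ n w² ≤ n δ w.
    subinterval-error : ∀ {δ u t v} → InUnit u → InUnit v → u ≤ t → t ≤ v → v - u < δ →
      ∣ f t * (v - u) - (F v - F u) ∣≤ ⟦ n ⟧ * δ * (v - u)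
    subinterval-error {δ} {u} {t} {v} u∈ v∈ u≤t t≤v w<δ = ∣∣≤-resp (sym error≈) refl
      (∣∣≤-weaken (∣∣≤-+ (∣∣≤-* (proj₂ (bounded P) t∈ u∈) (0≤⇒∣∣≤ (0≤-* 0≤x 0≤x)))
                         (∣∣≤-neg (∣∣≤-* (proj₂ (bounded P) t∈ v∈) (0≤⇒∣∣≤ (0≤-* 0≤y 0≤y)))))
        (≤-resp refl
          (solve 5 (λ n δ t u v → let x = t :- u; y = v :- t; w = v :- u in
              n :* ((δ :- w) :* w :+ (x :* y :+ x :* y))
              := n :* δ :* w :- (n :* (x :* x) :+ n :* (y :* y))) refl ⟦ n ⟧ δ t u v)
          (0≤-* (0≤⟦n⟧ n) (0≤-+ (0≤-* (<⇒≤ (x<y⇒0<y-x w<δ)) 0≤w) (0≤-+ (0≤-* 0≤x 0≤y) (0≤-* 0≤x 0≤y))))))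
      where
      t∈ : InUnit t
      t∈ = ≤-trans (proj₁ u∈) u≤t , ≤-trans t≤v (proj₂ v∈)
      0≤x = x≤y⇒0≤y-x u≤t
      0≤y = x≤y⇒0≤y-x t≤v
      0≤w = x≤y⇒0≤y-x (≤-trans u≤t t≤v)
      error≈ : f t * (v - u) - (F v - F u) ≈ q t u * ((t - u) * (t - u)) - q t v * ((v - t) * (v - t))
      error≈ = begin
        f t * (v - u) - (F v - F u)
          ≈⟨ solve 7 (λ f t u v x y z → f :* (v :- u) :- (x :- y)
               := (y :- z :- f :* (u :- t)) :- (x :- z :- f :* (v :- t)))
                    refl (f t) t u v (F v) (F u) (F t) ⟩
        (F u - F t - f t * (u - t)) - (F v - F t - f t * (v - t))
          ≈⟨ +-cong (taylor P t u) (-‿cong (taylor P t v)) ⟩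
        q t u * ((u - t) * (u - t)) - q t v * ((v - t) * (v - t))
          ≈⟨ +-congʳ (*-congˡ (solve 2 (λ t u → (u :- t) :* (u :- t) := (t :- u) :* (t :- u))
               refl t u)) ⟩
        q t u * ((t - u) * (t - u)) - q t v * ((v - t) * (v - t)) ∎

    first≤last : ∀ m (p : Fin (suc m) → Carrier) (t : Fin m → Carrier) →
      (∀ i → p (inject₁ i) ≤ t i) → (∀ i → t i ≤ p (suc i)) → p zero ≤ p (fromℕ m)
    first≤last zero    p t p≤t t≤p = ≤-reflexive refl
    first≤last (suc m) p t p≤t t≤p = ≤-trans (≤-trans (p≤t zero) (t≤p zero))
      (first≤last m (λ i → p (suc i)) (λ i → t (suc i)) (λ i → p≤t (suc i)) (λ i → t≤p (suc i)))

    -- The errors add up while the increments of `F` telescope. The end points may lie anywhere in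
    -- [0, 1], so that the induction can drop the first subinterval.
    riemannSum-error : ∀ {δ} m (p : Fin (suc m) → Carrier) (t : Fin m → Carrier) →
      (∀ i → p (inject₁ i) ≤ t i) → (∀ i → t i ≤ p (suc i)) →
      0# ≤ p zero → p (fromℕ m) ≤ 1# → (∀ i → p (suc i) - p (inject₁ i) < δ) →
      ∣ sum (λ i → f (t i) * (p (suc i) - p (inject₁ i))) - (F (p (fromℕ m)) - F (p zero)) ∣≤
        ⟦ n ⟧ * δ * (p (fromℕ m) - p zero)
    riemannSum-error {δ} zero p t p≤t t≤p 0≤p p≤1 w<δ = ∣∣≤-resp
      (solve 1 (λ x → :0 := :0 :- (x :- x)) refl (F (p zero)))
      (solve 2 (λ e x → :0 := e :* (x :- x)) refl (⟦ n ⟧ * δ) (p zero))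
      (0≤⇒∣∣≤ (≤-reflexive refl))
    riemannSum-error {δ} (suc m) p t p≤t t≤p 0≤p p≤1 w<δ = ∣∣≤-resp
      (solve 5 (λ s r x y z → (s :- (y :- x)) :+ (r :- (z :- y)) := s :+ r :- (z :- x)) refl
        (f (t zero) * (p₁ - p₀)) (sum (λ i → f (t (suc i)) * (p (suc (suc i)) - p (suc (inject₁ i)))))
        (F p₀) (F p₁) (F pₘ))
      (solve 4 (λ e x y z → e :* (y :- x) :+ e :* (z :- y) := e :* (z :- x))
           refl (⟦ n ⟧ * δ) p₀ p₁ pₘ)
      (∣∣≤-+
        (subinterval-error (0≤p , ≤-trans p₀≤p₁ p₁≤1) (0≤p₁ , p₁≤1) (p≤t zero) (t≤p zero) (w<δ zero))
        (riemannSum-error m (λ i → p (suc i)) (λ i → t (suc i)) (λ i → p≤t (suc i)) (λ i → t≤p (suc i))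
          0≤p₁ p≤1 (λ i → w<δ (suc i))))
      where
      p₀ = p zero
      p₁ = p (suc zero)
      pₘ = p (fromℕ (suc m))
      p₀≤p₁ = ≤-trans (p≤t zero) (t≤p zero)
      0≤p₁ = ≤-trans 0≤p p₀≤p₁
      p₁≤1 = ≤-trans (first≤last m (λ i → p (suc i)) (λ i → t (suc i))
                       (λ i → p≤t (suc i)) (λ i → t≤p (suc i))) p≤1

    fundamental-theorem : Integral 0# 1# f (F 1# - F 0#)
    fundamental-theorem ε 0<ε = δ , 0<x/n n 0<ε , within
      where
      -- The total error is at most n δ = ε - δ; the remaining δ makes the inequality strict.
      δ = ε / suc n
      within : ∀ (T : TaggedPartition 0# 1#) → let open TaggedPartition T in
        (∀ i → width i < δ) → Within ε (riemannSum f) (F 1# - F 0#)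
      within T w<δ =
          0<y-x⇒x<y (<-resp refl (trans (gap r) (solve 2 (λ ε r → ε :+ r := r :- (:- ε)) refl ε r))
            (0≤-+-0< (proj₂ error) (0<x/n n 0<ε)))
        , 0<y-x⇒x<y (<-resp refl (gap (- r)) (0≤-+-0< (proj₁ error) (0<x/n n 0<ε)))
        where
        open TaggedPartition T
        r = riemannSum f - (F 1# - F 0#)
        error : ∣ r ∣≤ ⟦ n ⟧ * δ
        error = ∣∣≤-resp
          (+-congˡ (-‿cong (+-cong (F-cong last) (-‿cong (F-cong first)))))
          (trans (*-congˡ (+-cong last (-‿cong first))) (solve 1 (λ e → e :* (:1 :- :0) := e)
               refl (⟦ n ⟧ * δ)))
          (riemannSum-error size point tag point≤tag tag≤point
            (≤-reflexive (sym first)) (≤-reflexive last) w<δ)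
        gap : ∀ x → ⟦ n ⟧ * δ + x + δ ≈ ε + x
        gap x = trans (solve 3 (λ n δ x → n :* δ :+ x :+ δ := (:1 :+ n) :* δ :+ x) refl ⟦ n ⟧ δ x)
                      (+-congʳ (n*[x/n]≈x ε (suc n)))

  -- Uniqueness of the integral.

  width≈ : ∀ {n} (i : Fin n) w → ⟦ suc (toℕ i) ⟧ * w - ⟦ toℕ (inject₁ i) ⟧ * w ≈ w
  width≈ i w = trans
    (+-congˡ (-‿cong (*-congʳ (reflexive (≡.cong ⟦_⟧ (toℕ-inject₁ i))))))
    (solve 2 (λ n w → (:1 :+ n) :* w :- n :* w := w) refl ⟦ toℕ i ⟧ w)

  uniformPartition : ℕ → TaggedPartition 0# 1#
  uniformPartition n = record
    { size      = suc n
    ; point     = point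
    ; tag       = λ i → point (inject₁ i)
    ; first     = zeroˡ _
    ; last      = trans (*-congʳ (reflexive (≡.cong ⟦_⟧ (toℕ-fromℕ (suc n))))) (n*[x/n]≈x 1# (suc n))
    ; point≤tag = λ i → ≤-reflexive refl
    ; tag≤point = λ i p<p → <⇒≤ 0<w (<-resp (width≈ i w) (-‿inverseʳ _) (+-monoˡ-< (- point (inject₁ i)) p<p))
    }
    where
    w = 1# / suc n
    0<w = 0<x/n n 0<1
    point : Fin (suc (suc n)) → Carrier
    point i = ⟦ toℕ i ⟧ * w

  -- A single Riemann sum within ε = (J - I) / 2 of both I and J would give J - I < 2 ε, which is
  -- absurd.
  Integral-unique-≮ : ∀ {f I J} → Integral 0# 1# f I → Integral 0# 1# f J → ¬ (I < J)
  Integral-unique-≮ {f} {I} {J} ∫I ∫J I<J = helper (∫I ε 0<ε) (∫J ε 0<ε)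
    where
    ε = (J - I) / 2
    0<ε : 0# < ε
    0<ε = 0<x/n 1 (x<y⇒0<y-x I<J)
    Fine : Carrier → Carrier → Set (a ⊔ ℓ₁ ⊔ ℓ₃)
    Fine δ K = ∀ (T : TaggedPartition 0# 1#) → let open TaggedPartition T in
      (∀ i → width i < δ) → Within ε (riemannSum f) K
    helper : ∃[ δ ] 0# < δ × Fine δ I → ¬ (∃[ δ ] 0# < δ × Fine δ J)
    helper (δ , 0<δ , fineI) (δ′ , 0<δ′ , fineJ) = helper′ (1/n<ε 0<δ) (1/n<ε 0<δ′)
      where
      helper′ : ∃[ n ] (∀ k → 1# / suc (n ℕ.+ k) < δ) → ¬ (∃[ n ] ∀ k → 1# / suc (n ℕ.+ k) < δ′)
      helper′ (m , <δ) (n , <δ′) = ≤-reflexive J-I≈2ε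
        (0<y-x⇒x<y (<-resp refl
          (solve 4 (λ ε s I J → (ε :- (s :- I)) :+ ((s :- J) :- (:- ε)) := (ε :+ ε) :- (J :- I))
               refl ε S I J)
          (0≤-+-0< (<⇒≤ (x<y⇒0<y-x (proj₂ inI))) (x<y⇒0<y-x (proj₁ inJ)))))
        where
        -- With m + n + 1 pieces the mesh is below both δ and δ′.
        T = uniformPartition (m ℕ.+ n)
        S = TaggedPartition.riemannSum T f
        inI : Within ε S I
        inI = fineI T (λ i → <-resp (sym (width≈ i (1# / suc (m ℕ.+ n)))) refl (<δ n))
        inJ : Within ε S J
        inJ = fineJ T (λ i → <-resp (trans (reflexive (≡.cong (λ k → 1# / suc k) (ℕ.+-comm n m)))
          (sym (width≈ i (1# / suc (m ℕ.+ n))))) refl (<δ′ m))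
        J-I≈2ε : ε + ε ≈ J - I
        J-I≈2ε = trans (solve 1 (λ ε → ε :+ ε := (:1 :+ (:1 :+ :0)) :* ε)
             refl ε) (n*[x/n]≈x (J - I) 2)

  Integral-unique : ∀ {f I J} → Integral 0# 1# f I → Integral 0# 1# f J → I ≈ J
  Integral-unique {f} ∫I ∫J = ≮∧≯⇒≈ (Integral-unique-≮ {f} ∫I ∫J) (Integral-unique-≮ {f} ∫J ∫I)

-- Cauchy polynomials as differences of integrated falling factorials.

module CauchyNumbers {a ℓ₁ ℓ₂ ℓ₃} (ℝ : RealField a ℓ₁ ℓ₂ ℓ₃) where

  open RealField ℝ hiding (zero)
  open Reals ℝ hiding (_⊛_)
  open OrderedField ℝ
  open Integration ℝ
  open import Algebra.Properties.Semiring.Mult semiring using (×-homo-1; ×1-homo-*)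
  open import Algebra.Properties.Semiring.Sum semiring using (sum-cong-≋; *-distribˡ-sum)
  open import Relation.Binary.Reasoning.Setoid setoid
  open IntegerRingSolver commutativeRing
  open Umbral commutativeRing hiding (⟦_⟧)

  ^-cong : ∀ k {x y} → x ≈ y → x ^ k ≈ y ^ k
  ^-cong zero    e = refl
  ^-cong (suc k) e = *-cong e (^-cong k e)

  1^n≈1 : ∀ n → 1# ^ n ≈ 1#
  1^n≈1 zero    = refl
  1^n≈1 (suc n) = trans (*-identityˡ _) (1^n≈1 n)

  -1^n*-1^n≈1 : ∀ n → (- 1#) ^ n * (- 1#) ^ n ≈ 1#
  -1^n*-1^n≈1 zero    = *-identityˡ 1#
  -1^n*-1^n≈1 (suc n) = trans
    (solve 1 (λ m → (:- :1) :* m :* ((:- :1) :* m) := m :* m) refl _) (-1^n*-1^n≈1 n)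

  [0-x]^n≈-1^n*x^n : ∀ x n → (0# - x) ^ n ≈ (- 1#) ^ n * x ^ n
  [0-x]^n≈-1^n*x^n x zero    = sym (*-identityˡ 1#)
  [0-x]^n≈-1^n*x^n x (suc n) = trans (*-congˡ ([0-x]^n≈-1^n*x^n x n))
    (solve 3 (λ x m p → (:0 :- x) :* (m :* p) := (:- :1) :* m :* (x :* p)) refl x _ _)

  n!*[x/n!]≈x : ∀ n x → ⟦ n ℕ.! ⟧ * (x / n !) ≈ x
  n!*[x/n!]≈x n x = n*[x/n]≈x x (n ℕ.!) {{n ℕ.!≢0}}

  x/n!≈1/n!*x : ∀ n x → x / n ! ≈ 1# / n ! * x
  x/n!≈1/n!*x n x = x/n≈1/n*x (n ℕ.!) {{n ℕ.!≢0}} x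

  integrals : Carrier → Sequence
  integrals z k = z ^ suc k / suc k

  n*integrals : ∀ z k → ⟦ suc k ⟧ * integrals z k ≈ powers z (suc k)
  n*integrals z k = n*[x/n]≈x (z ^ suc k) (suc k)

  -- ∫₀ˣ t (t - 1) ⋯ (t - n + 1) dt
  Φ : ℕ → Carrier → Carrier
  Φ n x = fall n (integrals x)

  Φ-cong : ∀ n {x y} → x ≈ y → Φ n x ≈ Φ n y
  Φ-cong n x≈y = fall-cong n (λ k → /-cong (suc k) (^-cong (suc k) x≈y))

  Φ-0 : ∀ n → Φ n 0# ≈ 0#
  Φ-0 n = begin
    fall n (integrals 0#)
      ≈⟨ fall-cong n (λ k → trans (/-cong (suc k) {0# ^ suc k} {0#} (zeroˡ (0# ^ k)))
                                       (trans (x/n≈1/n*x (suc k) 0#) (*-comm _ _))) ⟩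
    fall n (0# ⊙ λ k → 1# / suc k) ≈⟨ fall-⊙ n 0# (λ k → 1# / suc k) ⟩
    0# * fall n (λ k → 1# / suc k) ≈⟨ zeroˡ _ ⟩
    0#                             ∎

  -- The case α = 1, X t = t - x gives the first kind, the case α = - 1, X t = x - t the second.
  ∫binom : ∀ {X α} → Affine X α → Bounded (λ t _ → X t) → α * α ≈ 1# → ∀ n →
    Integral 0# 1# (λ t → binom (X t) n) ((α * (Φ n (X 1#) - Φ n (X 0#))) / n !)
  ∫binom {X} {α} affine bounded αα n ε 0<ε =
    let δ , 0<δ , fine = fundamental-theorem P ε 0<ε
    in δ , 0<δ , λ T w<δ → Within-resp (fine T w<δ)
    where
    r = 1# / n !
    G : Carrier → Carrier
    -- Since α α = 1, the slope α is its own inverse, and α times `integrals (X t) k` is an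
    -- antiderivative of X t ^ k.
    G t = r * fall n (λ k → α * integrals (X t) k)
    P : Primitive G (λ t → binom (X t) n)
    P = primitive-cong (λ _ → refl)
      (λ t → trans (*-congˡ (sym (product≈fall n (X t)))) (sym (x/n!≈1/n!*x n _)))
      (primitive-* r (primitive-fall n (primitive-powers affine bounded αα)))
    value : G 1# - G 0# ≈ (α * (Φ n (X 1#) - Φ n (X 0#))) / n !
    value = begin
      G 1# - G 0#
        ≈⟨ +-cong (*-congˡ (fall-⊙ n α _)) (-‿cong (*-congˡ (fall-⊙ n α _))) ⟩
      r * (α * Φ n (X 1#)) - r * (α * Φ n (X 0#))
        ≈⟨ solve 4 (λ r α x y → r :* (α :* x) :- r :* (α :* y) := r :* (α :* (x :- y)))
                                                                refl r α (Φ n (X 1#)) (Φ n (X 0#)) ⟩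
      r * (α * (Φ n (X 1#) - Φ n (X 0#)))                  ≈⟨ x/n!≈1/n!*x n _ ⟨
      (α * (Φ n (X 1#) - Φ n (X 0#))) / n !                ∎
    Within-resp : ∀ {s} → Within ε s (G 1# - G 0#) → Within ε s ((α * (Φ n (X 1#) - Φ n (X 0#))) / n !)
    Within-resp (p , q) = <-resp refl (+-congˡ (-‿cong value)) p , <-resp (+-congˡ (-‿cong value)) refl q

  ∫binom[t-x] : ∀ n x →
    Integral 0# 1# (λ t → binom (t - x) n) ((1# * (Φ n (1# - x) - Φ n (0# - x))) / n !)
  ∫binom[t-x] n x = ∫binom
    (λ t v → solve 3 (λ x t v → v :- x :- (t :- x) := :1 :* (v :- t)) refl x t v)
    (bounded-+ bounded-id (bounded-constant (- x))) (*-identityˡ 1#) n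

  ∫binom[x-t] : ∀ n x →
    Integral 0# 1# (λ t → binom (x - t) n) ((- 1# * (Φ n (x - 1#) - Φ n (x - 0#))) / n !)
  ∫binom[x-t] n x = ∫binom
    (λ t v → solve 3 (λ x t v → x :- v :- (x :- t) := (:- :1) :* (v :- t)) refl x t v)
    (bounded-+ (bounded-constant x) bounded--) (solve 0 ((:- :1) :* (:- :1) := :1) refl) n
    where
    bounded-- : Bounded (λ t _ → - t)
    bounded-- = 1 , λ t∈ v∈ → ∣∣≤-neg (proj₂ bounded-id t∈ v∈)

  cauchyPolynomials : CauchyPolynomials
  cauchyPolynomials = record
    { c     = λ n x → ⟦ n ℕ.! ⟧ * ((1# * (Φ n (1# - x) - Φ n (0# - x))) / n !)
    ; ĉ     = λ n x → ⟦ n ℕ.! ⟧ * ((- 1# * (Φ n (x - 1#) - Φ n (x - 0#))) / n !)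
    ; c-def = λ n x → _ , ∫binom[t-x] n x , refl
    ; ĉ-def = λ n x → _ , ∫binom[x-t] n x , refl
    }

  Φ-translate : ∀ n z → Φ (suc n) (1# + z) ≈ Φ (suc n) z + Φ (suc n) 1# + ⟦ suc n ⟧ * Φ n z
  Φ-translate n z = begin
    Φ n′ (1# + z)                                      ≈⟨ fall-cong n′ translated ⟩
    fall n′ (translate (integrals z) ⊕ integrals 1#)
      ≈⟨ fall-⊕ n′ (translate (integrals z)) (integrals 1#) ⟩
    fall n′ (translate (integrals z)) + Φ n′ 1#        ≈⟨ +-congʳ (fall-translate n (integrals z)) ⟩
    Φ n′ z + ⟦ n′ ⟧ * Φ n z + Φ n′ 1#
      ≈⟨ solve 3 (λ x y z → x :+ y :+ z := x :+ z :+ y) refl _ _ _ ⟩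
    Φ n′ z + Φ n′ 1# + ⟦ n′ ⟧ * Φ n z                  ∎
    where
    n′ = suc n
    -- The integral of tᵏ over [0, 1 + z] splits at 1, and the part beyond 1 is moved to [0, z] by t
    -- ↦ 1 + t. The algebraic proof clears the denominator k + 1.
    translated : integrals (1# + z) ≐ translate (integrals z) ⊕ integrals 1#
    translated k = ⟦1+n⟧*-cancelˡ k (begin
      ⟦ suc k ⟧ * integrals (1# + z) k                   ≈⟨ n*integrals (1# + z) k ⟩
      (1# + z) ^ suc k
        ≈⟨ solve 1 (λ x → x := x :- :1 :+ :1) refl _ ⟩
      (1# + z) ^ suc k - 1# + 1#
        ≈⟨ +-cong (+-congʳ (sym (translate-powers z (suc k)))) (sym (trans (n*integrals 1# k) (1^n≈1 (suc k)))) ⟩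
      translate (powers z) (suc k) - powers z 0 + ⟦ suc k ⟧ * integrals 1# k
        ≈⟨ +-congʳ (translate-primitive {powers z} {integrals z} (n*integrals z) k) ⟨
      ⟦ suc k ⟧ * translate (integrals z) k + ⟦ suc k ⟧ * integrals 1# k     ≈⟨ distribˡ _ _ _ ⟨
      ⟦ suc k ⟧ * (translate (integrals z) k + integrals 1# k) ∎)

  -- In all three formulas the summand differs from that of `stirling₁-fall` by a factor - 1, which
  -- raises the sign to (- 1)ⁿ⁺¹.
  stirling₁-sum : ∀ n b {f : Sequence} →
    (∀ i → f i ≈ - 1# * (⟦ stirling₁ n i ⟧ * alternate b i)) →
    sum {suc n} (λ i → f (toℕ i)) ≈ (- 1#) ^ suc n * fall n b
  stirling₁-sum n b {f} e = begin
    sum {suc n} (λ i → f (toℕ i))           ≈⟨ sum-cong-≋ {suc n} (λ i → e (toℕ i)) ⟩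
    sum {suc n} (λ i → - 1# * s (toℕ i))    ≈⟨ *-distribˡ-sum {suc n} (- 1#) (λ i → s (toℕ i)) ⟨
    - 1# * sum {suc n} (λ i → s (toℕ i))    ≈⟨ *-congˡ (stirling₁-fall n b (ℕ.n<1+n n)) ⟩
    - 1# * ((- 1#) ^ n * fall n b)          ≈⟨ *-assoc _ _ _ ⟨
    (- 1#) ^ suc n * fall n b               ∎
    where
    s : Sequence
    s i = ⟦ stirling₁ n i ⟧ * alternate b i

  cancel-signs : ∀ n x y → (- 1#) ^ n * x * ((- 1#) ^ n * y) ≈ x * y
  cancel-signs n x y = trans
    (solve 3 (λ m x y → m :* x :* (m :* y) := m :* m :* (x :* y)) refl ((- 1#) ^ n) x y)
    (trans (*-congʳ (-1^n*-1^n≈1 n)) (*-identityˡ _))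

  -- Bernoulli numbers and the value of cₙ.

  -- Stands to `alternate B` as `integrals z` stands to `powers z`. Its entries are - ζ(- k) for the
  -- Riemann zeta function. The sign makes `alternate` of it equal to - Bₖ₊₁ / (k + 1), the
  -- Bernoulli quotient of the third formula up to the factor - 1.
  bernoulliSequence : Sequence
  bernoulliSequence k = (- 1#) ^ suc k * B (suc k) / suc k

  1/n! : Sequence
  1/n! n = 1# / n !

  1/0!≈1 : 1/n! 0 ≈ 1#
  1/0!≈1 = trans (solve 1 (λ x → x := (:1 :+ :0) :* x) refl (1/n! 0)) (n!*[x/n!]≈x 0 1#)

  derivative-1/n! : derivative 1/n! ≐ 1/n!
  derivative-1/n! n = begin
    ⟦ suc n ⟧ * 1/n! (suc n)                              ≈⟨ *-identityˡ _ ⟨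
    1# * (⟦ suc n ⟧ * 1/n! (suc n))                       ≈⟨ *-congʳ (n!*[x/n!]≈x n 1#) ⟨
    ⟦ n ℕ.! ⟧ * 1/n! n * (⟦ suc n ⟧ * 1/n! (suc n))
      ≈⟨ solve 4 (λ f r s q → f :* r :* (s :* q) := s :* f :* q :* r) refl _ _ _ _ ⟩
    ⟦ suc n ⟧ * ⟦ n ℕ.! ⟧ * 1/n! (suc n) * 1/n! n
      ≈⟨ *-congʳ (*-congʳ (×1-homo-* (suc n) (n ℕ.!))) ⟨
    ⟦ suc n ℕ.! ⟧ * 1/n! (suc n) * 1/n! n                  ≈⟨ *-congʳ (n!*[x/n!]≈x (suc n) 1#) ⟩
    1# * 1/n! n                                            ≈⟨ *-identityˡ _ ⟩
    1/n! n                                                 ∎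

  exp⊛ : ∀ g n → (1/n! ⊛ g) n ≈ g n + (expm1 ⊛ g) n
  exp⊛ g zero    = trans (+-congʳ (*-congʳ 1/0!≈1))
    (solve 1 (λ x → :1 :* x :+ :0 := x :+ (:0 :* x :+ :0)) refl (g 0))
  exp⊛ g (suc n) = trans (+-congʳ (*-congʳ 1/0!≈1))
    (solve 2 (λ x y → :1 :* x :+ y := x :+ (:0 :* x :+ y))
         refl (g (suc n)) (((λ i → expm1 (suc i)) ⊛ g) n))

  -- For the exponential generating function G of the Bernoulli numbers, eᵗ G = G + (eᵗ - 1) G = G +
  -- t. Umbrally, (1 + B)ⁿ = Bⁿ + δ.
  translate-B : translate B ≐ B ⊕ λ n → δ n 1
  translate-B n = begin
    translate B n                                     ≈⟨ translate-⊛ 1/0!≈1 derivative-1/n! B n ⟩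
    ⟦ n ℕ.! ⟧ * (1/n! ⊛ (λ k → B k * 1/n! k)) n
      ≈⟨ *-congˡ (⊛-congˡ {1/n!} (λ k → trans (*-comm _ _) (sym (x/n!≈1/n!*x k (B k)))) n) ⟩
    ⟦ n ℕ.! ⟧ * (1/n! ⊛ egf B) n                      ≈⟨ *-congˡ (exp⊛ (egf B) n) ⟩
    ⟦ n ℕ.! ⟧ * (egf B n + (expm1 ⊛ egf B) n)         ≈⟨ *-congˡ (+-congˡ (expm1⊛egf-B n)) ⟩
    ⟦ n ℕ.! ⟧ * (egf B n + δ n 1)                     ≈⟨ distribˡ _ _ _ ⟩
    ⟦ n ℕ.! ⟧ * egf B n + ⟦ n ℕ.! ⟧ * δ n 1           ≈⟨ +-cong (n!*[x/n!]≈x n (B n)) (n!*δ n) ⟩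
    B n + δ n 1                                       ∎
    where
    n!*δ : ∀ n → ⟦ n ℕ.! ⟧ * δ n 1 ≈ δ n 1
    n!*δ zero          = zeroʳ _
    n!*δ (suc zero)    = trans (*-identityʳ _) (×-homo-1 1#)
    n!*δ (suc (suc n)) = zeroʳ _

  -- Both sides of `translated` are applied to the falling factorial: evaluation at 1 leaves the
  -- delta, and by `fall-translate` the passage from b to `translate b` costs n′ times `fall n b`.
  Φ-1 : ∀ n → Φ (suc n) 1# ≈ δ (suc n) 1 - ⟦ suc n ⟧ * fall n bernoulliSequence
  Φ-1 n = begin
    Φ n′ 1#
      ≈⟨ solve 3 (λ x y z → x := x :+ (y :+ z) :- y :- z) refl (Φ n′ 1#) (fall n′ b) nb ⟩
    Φ n′ 1# + (fall n′ b + nb) - fall n′ b - nb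
      ≈⟨ +-congʳ (+-congʳ (+-congˡ (fall-translate n b))) ⟨
    Φ n′ 1# + fall n′ (translate b) - fall n′ b - nb
      ≈⟨ +-congʳ (+-congʳ (fall-⊕ n′ (integrals 1#) (translate b))) ⟨
    fall n′ (integrals 1# ⊕ translate b) - fall n′ b - nb
      ≈⟨ +-congʳ (+-congʳ (fall-cong n′ translated)) ⟩
    fall n′ (powers 1# ⊕ b) - fall n′ b - nb
      ≈⟨ +-congʳ (+-congʳ (fall-⊕ n′ (powers 1#) b)) ⟩
    fall n′ (powers 1#) + fall n′ b - fall n′ b - nb
      ≈⟨ solve 3 (λ x y z → x :+ y :- y :- z := x :- z) refl _ _ _ ⟩
    fall n′ (powers 1#) - nb                    ≈⟨ +-congʳ (fall-1 n) ⟩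
    δ n′ 1 - nb                                 ∎
    where
    n′ = suc n
    b  = bernoulliSequence
    nb = ⟦ n′ ⟧ * fall n b
    fall-1 : ∀ n → fall (suc n) (powers 1#) ≈ δ (suc n) 1
    fall-1 zero    = solve 0 (:1 :* :1 :- :0 :* :1 := :1) refl
    fall-1 (suc n) = fall-powers-1 n
    B₀≈1 : alternate B 0 ≈ 1#
    B₀≈1 = solve 0 (:1 :* ((:1 :+ :0) :* :1) := :1) refl
    -- Here `translate-primitive` is used with `alternate B` in the role of evaluation at a point.
    -- The increment k + 1 from `translate-alternate` becomes the constant 1 after division by k +
    -- 1.
    translated : integrals 1# ⊕ translate b ≐ powers 1# ⊕ b
    translated k = ⟦1+n⟧*-cancelˡ k (begin
      N * (integrals 1# k + translate b k)      ≈⟨ distribˡ _ _ _ ⟩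
      N * integrals 1# k + N * translate b k
        ≈⟨ +-cong (trans (n*integrals 1# k) (1^n≈1 (suc k)))
             (translate-primitive {alternate B} {b} (λ i → n*[x/n]≈x _ (suc i)) k) ⟩
      1# + (translate (alternate B) (suc k) - alternate B 0)
        ≈⟨ +-congˡ (+-cong (translate-alternate translate-B refl refl (λ _ → refl) (suc k)) (-‿cong B₀≈1)) ⟩
      1# + (alternate B (suc k) + N - 1#)
        ≈⟨ +-congˡ (+-congʳ (+-congʳ (n*[x/n]≈x _ (suc k)))) ⟨
      1# + (N * b k + N - 1#)
        ≈⟨ solve 2 (λ N x → :1 :+ (N :* x :+ N :- :1) := N :* (:1 :+ x)) refl N (b k) ⟩
      N * (1# + b k)                            ≈⟨ *-congˡ (+-congʳ (1^n≈1 k)) ⟨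
      N * (powers 1# k + b k)                   ∎)
      where N = ⟦ suc k ⟧

  -- The three formulas for an arbitrary family of Cauchy polynomials.

  module _ (C : CauchyPolynomials) where
    open CauchyPolynomials C

    -- The integral supplied by `C` is known only through the relation `Integral`; uniqueness
    -- identifies it with the computed one.
    c≈ : ∀ n x → c n x ≈ Φ n (1# - x) - Φ n (0# - x)
    c≈ n x = begin
      c n x                 ≈⟨ proj₂ (proj₂ (c-def n x)) ⟩
      ⟦ n ℕ.! ⟧ * proj₁ (c-def n x)
        ≈⟨ *-congˡ (Integral-unique {λ t → binom (t - x) n} (proj₁ (proj₂ (c-def n x))) (∫binom[t-x] n x)) ⟩
      ⟦ n ℕ.! ⟧ * ((1# * (Φ n (1# - x) - Φ n (0# - x))) / n !) ≈⟨ n!*[x/n!]≈x n _ ⟩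
      1# * (Φ n (1# - x) - Φ n (0# - x)) ≈⟨ *-identityˡ _ ⟩
      Φ n (1# - x) - Φ n (0# - x) ∎

    ĉ≈ : ∀ n x → ĉ n x ≈ Φ n x - Φ n (x - 1#)
    ĉ≈ n x = begin
      ĉ n x                 ≈⟨ proj₂ (proj₂ (ĉ-def n x)) ⟩
      ⟦ n ℕ.! ⟧ * proj₁ (ĉ-def n x)
        ≈⟨ *-congˡ (Integral-unique {λ t → binom (x - t) n} (proj₁ (proj₂ (ĉ-def n x))) (∫binom[x-t] n x)) ⟩
      ⟦ n ℕ.! ⟧ * ((- 1# * (Φ n (x - 1#) - Φ n (x - 0#))) / n !) ≈⟨ n!*[x/n!]≈x n _ ⟩
      - 1# * (Φ n (x - 1#) - Φ n (x - 0#))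
        ≈⟨ solve 2 (λ x y → (:- :1) :* (x :- y) := y :- x) refl _ _ ⟩
      Φ n (x - 0#) - Φ n (x - 1#) ≈⟨ +-congʳ (Φ-cong n (solve 1 (λ x → x :- :0 := x) refl x)) ⟩
      Φ n x - Φ n (x - 1#) ∎

    cauchyNumber₁≈ : ∀ n → cauchyNumber₁ n ≈ Φ n 1#
    cauchyNumber₁≈ n = begin
      c n 0#                        ≈⟨ c≈ n 0# ⟩
      Φ n (1# - 0#) - Φ n (0# - 0#) ≈⟨ +-cong (Φ-cong n (solve 0 (:1 :- :0 := :1) refl))
                                         (-‿cong (trans (Φ-cong n (-‿inverseʳ 0#)) (Φ-0 n))) ⟩
      Φ n 1# - 0#                   ≈⟨ solve 1 (λ x → x :- :0 := x) refl _ ⟩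
      Φ n 1#                        ∎

    -- Common core of the first two formulas, with z = - x for the first kind and z = x - 1 for the
    -- second. The sign of the Stirling sum is introduced in pairs, as (- 1)ⁿ′ (- 1)ⁿ′ = 1.
    difference : ∀ n {w} z {f : Sequence} → w ≈ 1# + z →
      (∀ i → f i ≈ - 1# * (⟦ stirling₁ n i ⟧ * alternate (integrals z) i)) →
      Φ (suc n) w - Φ (suc n) z ≈
        cauchyNumber₁ (suc n) + (- 1#) ^ suc n * ⟦ suc n ⟧ * sum {suc n} (λ i → f (toℕ i))
    difference n {w} z {f} w≈1+z e = begin
      Φ n′ w - Φ n′ z
        ≈⟨ +-congʳ (trans (Φ-cong n′ w≈1+z) (Φ-translate n z)) ⟩
      Φ n′ z + Φ n′ 1# + ⟦ n′ ⟧ * Φ n z - Φ n′ z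
        ≈⟨ solve 3 (λ x y z → x :+ y :+ z :- x := y :+ z) refl _ _ _ ⟩
      Φ n′ 1# + ⟦ n′ ⟧ * Φ n z
        ≈⟨ +-cong (cauchyNumber₁≈ n′) (cancel-signs n′ ⟦ n′ ⟧ (Φ n z)) ⟨
      cauchyNumber₁ n′ + (- 1#) ^ n′ * ⟦ n′ ⟧ * ((- 1#) ^ n′ * Φ n z)
        ≈⟨ +-congˡ (*-congˡ (stirling₁-sum n (integrals z) {f} e)) ⟨
      cauchyNumber₁ n′ + (- 1#) ^ n′ * ⟦ n′ ⟧ * sum {n′} (λ i → f (toℕ i)) ∎
      where n′ = suc n

    formula-c : ∀ n x → Formula-c C (suc n) x
    formula-c n x = trans (c≈ (suc n) x) (difference n (0# - x)
      {λ i → 1# / suc i * ⟦ stirling₁ n i ⟧ * x ^ suc i}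
      (solve 1 (λ x → :1 :- x := :1 :+ (:0 :- x)) refl x) term)
      where
      term : ∀ i → 1# / suc i * ⟦ stirling₁ n i ⟧ * x ^ suc i ≈
        - 1# * (⟦ stirling₁ n i ⟧ * alternate (integrals (0# - x)) i)
      term i = begin
        r * s * p
          ≈⟨ *-identityˡ _ ⟨
        1# * (r * s * p)
          -- One copy of m becomes the sign of `alternate`, the other goes with a further - 1 into
          -- the power of 0 - x.
          ≈⟨ *-congʳ (-1^n*-1^n≈1 i) ⟨
        m * m * (r * s * p)
          ≈⟨ solve 4 (λ m r s p → m :* m :* (r :* s :* p) := (:- :1) :* (s :* (m :* (r :* ((:- :1) :* m :* p)))))
               refl m r s p ⟩
        - 1# * (s * (m * (r * ((- 1#) ^ suc i * p))))
          ≈⟨ *-congˡ (*-congˡ (*-congˡ (*-congˡ ([0-x]^n≈-1^n*x^n x (suc i))))) ⟨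
        - 1# * (s * (m * (r * (0# - x) ^ suc i)))
          ≈⟨ *-congˡ (*-congˡ (*-congˡ (x/n≈1/n*x (suc i) ((0# - x) ^ suc i)))) ⟨
        - 1# * (s * (m * integrals (0# - x) i)) ∎
        where
        r = 1# / suc i
        s = ⟦ stirling₁ n i ⟧
        m = (- 1#) ^ i
        p = x ^ suc i

    formula-ĉ : ∀ n x → Formula-ĉ C (suc n) x
    formula-ĉ n x = trans (ĉ≈ (suc n) x) (difference n (x - 1#)
      {λ i → (- 1#) ^ suc i / suc i * ⟦ stirling₁ n i ⟧ * (x - 1#) ^ suc i}
      (solve 1 (λ x → x := :1 :+ (x :- :1)) refl x) term)
      where
      term : ∀ i → (- 1#) ^ suc i / suc i * ⟦ stirling₁ n i ⟧ * (x - 1#) ^ suc i ≈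
        - 1# * (⟦ stirling₁ n i ⟧ * alternate (integrals (x - 1#)) i)
      term i = begin
        (- 1#) ^ suc i / suc i * s * p   ≈⟨ *-congʳ (*-congʳ (x/n≈1/n*x (suc i) ((- 1#) ^ suc i))) ⟩
        r * (- 1# * m) * s * p
          ≈⟨ solve 4 (λ m r s p → r :* ((:- :1) :* m) :* s :* p := (:- :1) :* (s :* (m :* (r :* p))))
               refl m r s p ⟩
        - 1# * (s * (m * (r * p)))       ≈⟨ *-congˡ (*-congˡ (*-congˡ (x/n≈1/n*x (suc i) p))) ⟨
        - 1# * (s * (m * integrals (x - 1#) i)) ∎
        where
        r = 1# / suc i
        s = ⟦ stirling₁ n i ⟧
        m = (- 1#) ^ i
        p = (x - 1#) ^ suc i

    formula-cauchyNumber₁ : ∀ n → Formula-cauchyNumber₁ C (suc n)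
    formula-cauchyNumber₁ n = begin
      cauchyNumber₁ n′                    ≈⟨ cauchyNumber₁≈ n′ ⟩
      Φ n′ 1#                             ≈⟨ Φ-1 n ⟩
      δ n′ 1 - ⟦ n′ ⟧ * fall n b          ≈⟨ +-congˡ (-‿cong (cancel-signs n′ ⟦ n′ ⟧ (fall n b))) ⟨
      δ n′ 1 - (- 1#) ^ n′ * ⟦ n′ ⟧ * ((- 1#) ^ n′ * fall n b)
        ≈⟨ solve 4 (λ d m N x → d :- m :* N :* x := d :+ (:- :1) :* m :* N :* x)
             refl (δ n′ 1) ((- 1#) ^ n′) ⟦ n′ ⟧ _ ⟩
      δ n′ 1 + (- 1#) ^ suc n′ * ⟦ n′ ⟧ * ((- 1#) ^ n′ * fall n b)
        ≈⟨ +-congˡ (*-cong (*-congʳ (reflexive (≡.cong ((- 1#) ^_) (ℕ.+-comm 1 n′))))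
             (sym (stirling₁-sum n b {λ i → ⟦ stirling₁ n i ⟧ * (B (suc i) / suc i)} term))) ⟩
      δ n′ 1 + (- 1#) ^ (n′ ℕ.+ 1) * ⟦ n′ ⟧ *
        sum {n′} (λ i → ⟦ stirling₁ n (toℕ i) ⟧ * (B (suc (toℕ i)) / suc (toℕ i))) ∎
      where
      n′ = suc n
      b  = bernoulliSequence
      term : ∀ i → ⟦ stirling₁ n i ⟧ * (B (suc i) / suc i) ≈ - 1# * (⟦ stirling₁ n i ⟧ * alternate b i)
      term i = begin
        s * (B (suc i) / suc i)              ≈⟨ *-congˡ (x/n≈1/n*x (suc i) (B (suc i))) ⟩
        s * (r * B′)                         ≈⟨ *-identityˡ _ ⟨
        1# * (s * (r * B′))                  ≈⟨ *-congʳ (-1^n*-1^n≈1 i) ⟨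
        m * m * (s * (r * B′))
          ≈⟨ solve 4 (λ m r s p → m :* m :* (s :* (r :* p)) := (:- :1) :* (s :* (m :* (r :* ((:- :1) :* m :* p)))))
               refl m r s B′ ⟩
        - 1# * (s * (m * (r * ((- 1#) ^ suc i * B′))))
          ≈⟨ *-congˡ (*-congˡ (*-congˡ (x/n≈1/n*x (suc i) ((- 1#) ^ suc i * B′)))) ⟨
        - 1# * (s * (m * b i))               ∎
        where
        r = 1# / suc i
        s = ⟦ stirling₁ n i ⟧
        m = (- 1#) ^ i
        B′ = B (suc i)

theorem1 : ∀ {a ℓ₁ ℓ₂ ℓ₃} (ℝ : RealField a ℓ₁ ℓ₂ ℓ₃) →
    Reals.CauchyPolynomials ℝ ×
    (∀ (C : Reals.CauchyPolynomials ℝ) (n : ℕ) .{{_ : NonZero n}} →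
    (∀ x → Reals.Formula-c ℝ C n x) ×
    (∀ x → Reals.Formula-ĉ ℝ C n x) ×
    Reals.Formula-cauchyNumber₁ ℝ C n)
theorem1 ℝ = cauchyPolynomials , λ { C (suc n) →
    formula-c C n , formula-ĉ C n , formula-cauchyNumber₁ C n }
  where open CauchyNumbers ℝ
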